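{- For all integers $n\geq 0$, $$a_{1^{1}2^{1}3^{ -2}}(3n)>0,\qquad a_{1^{1}2^{1}3^{ -2}}(3n+1)<0,\qquad a_{1^{1}2^{1}3^{ -2}}(3n+2)<0.$$
   Context: For $|q|<1$ (or as formal power series in $q$) let $f_j:=(q^j;q^j)_\infty=\prod_{k\ge 1}(1-q^{jk})$ for each positive integer $j$. The integers $a_{1^{1}2^{1}3^{ -2}}(n)$, $n\ge 0$, are defined by $\sum_{n=0}^\infty a_{1^{1}2^{1}3^{ -2}}(n)q^n=\dfrac{f_1f_2}{f_3^2}$. -}

module Defs where

open import Data.Bool using (if_then_else_)
open import Data.Fin using (Fin; toℕ)
open import Data.Fin.Properties using (toℕ<n)
open import Data.Integer using (ℤ; 0ℤ; 1ℤ; _+_; _*_; _-_)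
open import Data.Integer.Properties
  using (+-0-commutativeMonoid; *-identityˡ; *-identityʳ; +-identityʳ; *-zeroˡ)
open import Data.Integer.Tactic.RingSolver using (solve-∀)
import Data.Nat as ℕ
open import Data.Nat using (ℕ; zero; suc; _∸_; _<_; NonZero)
import Data.Nat.Properties as ℕ
open import Relation.Nullary using (does)
open import Relation.Nullary.Decidable using (dec-false)
open import Relation.Binary.PropositionalEquality

open import Algebra.Properties.CommutativeMonoid.Sum +-0-commutativeMonoid
  using (sum; sum-cong-≋; sum-replicate-zero)

-- Formal power series in q over ℤ: A n is the coefficient of qⁿ.
Series : Set
Series = ℕ → ℤ

infixl 7 _⊛_ _÷_
infixl 6 _⊖_

q^_ : ℕ → Series
(q^ m) n = if does (n ℕ.≟ m) then 1ℤ else 0ℤ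

_⊖_ : Series → Series → Series
(A ⊖ B) n = A n - B n

_⊛_ : Series → Series → Series
(A ⊛ B) n = sum {suc n} λ i → A (toℕ i) * B (n ∸ toℕ i)

-- Long division, for a divisor with constant term 1:
--   A / B = A₀ + q · ((A - A₀ B) / q) / B.
-- It is the quotient only under that condition; see ÷-⊛.
_÷_ : Series → Series → Series
(A ÷ B) zero    = A 0
(A ÷ B) (suc n) = ((λ k → A (suc k) - A 0 * B (suc k)) ÷ B) n

÷-⊛ : ∀ A B → B 0 ≡ 1ℤ → ∀ n → (A ÷ B ⊛ B) n ≡ A n
÷-⊛ A B B₀≡1 zero = begin
  A 0 * B 0 + 0ℤ  ≡⟨ +-identityʳ _ ⟩
  A 0 * B 0       ≡⟨ cong (A 0 *_) B₀≡1 ⟩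
  A 0 * 1ℤ        ≡⟨ *-identityʳ _ ⟩
  A 0             ∎
  where open ≡-Reasoning
÷-⊛ A B B₀≡1 (suc n) = begin
  A 0 * B (suc n) + (A′ ÷ B ⊛ B) n                   ≡⟨ cong (A 0 * B (suc n) +_) (÷-⊛ A′ B B₀≡1 n) ⟩
  A 0 * B (suc n) + (A (suc n) - A 0 * B (suc n))    ≡⟨ cancel (A 0 * B (suc n)) (A (suc n)) ⟩
  A (suc n)                                          ∎
  where
  open ≡-Reasoning
  A′ : Series
  A′ k = A (suc k) - A 0 * B (suc k)
  cancel : ∀ x y → x + (y - x) ≡ y
  cancel = solve-∀

-- ∏_{k=1}^{N} (1 - q^{jk})
partialProduct : ℕ → ℕ → Series
partialProduct j zero    = q^ 0
partialProduct j (suc N) = (q^ 0 ⊖ q^ (j ℕ.* suc N)) ⊛ partialProduct j N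

-- f j = (q^j ; q^j)_∞.  For j ≥ 1 the factors with k > n do not affect the
-- coefficient of qⁿ, so it can be read off the n-th partial product; see f-limit.
f : (j : ℕ) → .{{NonZero j}} → Series
f j n = partialProduct j n n

private
  q^-≢ : ∀ {m n} → n ≢ m → (q^ m) n ≡ 0ℤ
  q^-≢ {m} {n} n≢m = cong (if_then 1ℤ else 0ℤ) (dec-false (n ℕ.≟ m) n≢m)

  1-q^m-⊛ : ∀ m A n → n < m → ((q^ 0 ⊖ q^ m) ⊛ A) n ≡ A n
  1-q^m-⊛ m A n n<m = begin
    (1ℤ - (q^ m) 0) * A n + sum tail            ≡⟨ cong₂ (λ x y → (1ℤ - x) * A n + y) (q^-≢ 0≢m) tail≡0 ⟩
    1ℤ * A n + 0ℤ                               ≡⟨ +-identityʳ _ ⟩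
    1ℤ * A n                                    ≡⟨ *-identityˡ _ ⟩
    A n                                         ∎
    where
    open ≡-Reasoning
    0≢m : 0 ≢ m
    0≢m = ℕ.<⇒≢ (ℕ.≤-<-trans ℕ.z≤n n<m)
    tail : Fin n → ℤ
    tail = λ i → (0ℤ - (q^ m) (suc (toℕ i))) * A (n ∸ suc (toℕ i))
    tail≡0 : sum tail ≡ 0ℤ
    tail≡0 = trans
      (sum-cong-≋ λ i → trans
        (cong (λ x → (0ℤ - x) * A (n ∸ suc (toℕ i)))
          (q^-≢ (ℕ.<⇒≢ (ℕ.≤-<-trans (toℕ<n i) n<m))))
        (*-zeroˡ (A (n ∸ suc (toℕ i)))))
      (sum-replicate-zero n)

f-limit : ∀ j .{{_ : NonZero j}} n d → partialProduct j (d ℕ.+ n) n ≡ f j n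
f-limit j n zero    = refl
f-limit j n (suc d) = trans
  (1-q^m-⊛ (j ℕ.* suc (d ℕ.+ n)) (partialProduct j (d ℕ.+ n)) n
    (ℕ.≤-trans (ℕ.s≤s (ℕ.m≤n+m n d)) (ℕ.m≤n*m (suc (d ℕ.+ n)) j)))
  (f-limit j n d)

a-1¹2¹3⁻² : Series
a-1¹2¹3⁻² = (f 1 ⊛ f 2) ÷ (f 3 ⊛ f 3)

a-1¹2¹3⁻²-generating : ∀ n → (a-1¹2¹3⁻² ⊛ (f 3 ⊛ f 3)) n ≡ (f 1 ⊛ f 2) n
a-1¹2¹3⁻²-generating = ÷-⊛ (f 1 ⊛ f 2) (f 3 ⊛ f 3) refl

{-# OPTIONS --safe #-}
-- By the Jacobi triple product, f₁²/f₂ = φ(-q) = Σ (-1)^n q^(n²) and 2 f₂²/f₁ = 2 ψ(q) = Σ q^(n(n-1)/2), with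
-- n running over ℤ. Splitting both sums by n mod 3 and multiplying them gives the 3-dissection
--   f₁ f₂ = f₆ f₉⁴ / (f₃ f₁₈²) - q f₉ f₁₈ - 2 q² f₃ f₁₈⁴ / (f₆ f₉²).
-- After division by f₃² and the substitution q³ → q its three parts are, up to the factors 1, -1, -2,
--   f₂ f₃⁴ / (f₁³ f₆²),  f₃ f₆ / f₁²,  f₆⁴ / (f₁ f₂ f₃²).
-- Each is f₃/f₁ = ∏ (1 + q^k + q^(2k)), all of whose coefficients are positive, times a series with nonnegative
-- coefficients and positive constant term. For the first part this rests on
--   f₃² / (f₁ f₆) = ∏ (1 - q^(6k-3)) / ((1 - q^(3k-2)) (1 - q^(3k-1))),
-- where the exponent in the numerator is the sum of the two in the denominator.
--
-- Everything takes place in ℤ[[q]]/(q^N), where infinite products and sums are finite and 1 - q^k is a unit.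
module Submission where

open import Defs
open import Algebra.Bundles using (CommutativeRing)
open import Data.Fin.Base using (toℕ)
open import Data.Fin.Properties using (toℕ<n)
open import Data.Nat.Base as ℕ using (ℕ; zero; suc)
import Data.Nat.Properties as ℕ
open import Data.Product using (∃; _×_; _,_; proj₁)
open import Data.Sum using (_⊎_; inj₁; inj₂)
open import Relation.Binary.PropositionalEquality as ≡ using (_≡_)
open import Relation.Nullary using (yes; no)
open import Relation.Nullary.Decidable using (dec-true; dec-false)

-- Serves `E-binom-θ`: if k exceeds n by at most N, the complementary index n + n - k of the
-- binomial coefficient is still at least N.
N+k≤n+n : ∀ {N n k} → k ℕ.≤ n ℕ.+ N → N ℕ.+ N ℕ.≤ n → N ℕ.+ k ℕ.≤ n ℕ.+ n
N+k≤n+n {N} {n} {k} k≤n+N 2N≤n = begin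
  N ℕ.+ k              ≤⟨ ℕ.+-monoʳ-≤ N k≤n+N ⟩
  N ℕ.+ (n ℕ.+ N)      ≡⟨ rearrange N n ⟩
  n ℕ.+ (N ℕ.+ N)      ≤⟨ ℕ.+-monoʳ-≤ n 2N≤n ⟩
  n ℕ.+ n              ∎
  where
  open import Data.Nat.Tactic.RingSolver using (solve-∀)
  open ℕ.≤-Reasoning
  rearrange : ∀ N n → N ℕ.+ (n ℕ.+ N) ≡ n ℕ.+ (N ℕ.+ N)
  rearrange = solve-∀

-- Finite products and sums in a commutative ring

module QProducts {c ℓ} (R : CommutativeRing c ℓ) where

  open import Data.Nat.Base using (_≤_; _<_; s≤s)
  open import Data.Nat.Tactic.RingSolver using (solve-∀)
  open CommutativeRing R hiding (zero)
  open import Algebra.Properties.CommutativeSemiring.Exp commutativeSemiring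
  open import Algebra.Properties.Semiring.Sum semiring using (sum; sum-cong-≋; ∑-distrib-+; *-distribˡ-sum)
  open import Algebra.Solver.Ring.NaturalCoefficients.Default commutativeSemiring
  open import Relation.Binary.Reasoning.Setoid setoid

  -- The solver is the one for commutative semirings, so -1 enters it as a free variable. Identities
  -- that rest on 1 + -1 = 0 are closed by `cancel-1`.
  -1# : Carrier
  -1# = - 1#

  1+-1≈0 : 1# + -1# ≈ 0#
  1+-1≈0 = -‿inverseʳ 1#

  -1*-1≈1 : -1# * -1# ≈ 1#
  -1*-1≈1 = begin
    -1# * -1#                             ≈⟨ +-identityʳ _ ⟨
    -1# * -1# + 0#                        ≈⟨ +-congˡ 1+-1≈0 ⟨
    -1# * -1# + (1# + -1#)                ≈⟨ solve 1 (λ e → e :* e :+ (con 1 :+ e) := con 1 :+ (con 1 :+ e) :* e) refl -1# ⟩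
    1# + (1# + -1#) * -1#                 ≈⟨ +-congˡ (trans (*-congʳ 1+-1≈0) (zeroˡ -1#)) ⟩
    1# + 0#                               ≈⟨ +-identityʳ 1# ⟩
    1#                                    ∎

  cancel-1 : ∀ x y → x + (1# + -1#) * y ≈ x
  cancel-1 x y = trans (+-congˡ (trans (*-congʳ 1+-1≈0) (zeroˡ y))) (+-identityʳ x)

  -- Opaque, so that the summand can be inferred from the sum.
  opaque
    ∑< : ℕ → (ℕ → Carrier) → Carrier
    ∑< n g = sum {n} (λ i → g (toℕ i))

  opaque
    unfolding ∑<

    ∑-zero : ∀ g → ∑< 0 g ≈ 0#
    ∑-zero g = refl

    ∑-first : ∀ n g → ∑< (suc n) g ≈ g 0 + ∑< n (λ k → g (suc k))
    ∑-first n g = refl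

    ∑-cong-< : ∀ n {g h} → (∀ k → k < n → g k ≈ h k) → ∑< n g ≈ ∑< n h
    ∑-cong-< n g≈h = sum-cong-≋ {n} λ i → g≈h (toℕ i) (toℕ<n i)

    ∑-+ : ∀ n g h → ∑< n (λ k → g k + h k) ≈ ∑< n g + ∑< n h
    ∑-+ n g h = ∑-distrib-+ {n} (λ i → g (toℕ i)) (λ i → h (toℕ i))

    ∑-* : ∀ n x g → ∑< n (λ k → x * g k) ≈ x * ∑< n g
    ∑-* n x g = sym (*-distribˡ-sum {n} x (λ i → g (toℕ i)))

    ∑-last : ∀ n g → ∑< (suc n) g ≈ ∑< n g + g n
    ∑-last zero    g = +-comm (g 0) 0#
    ∑-last (suc n) g = trans (+-congˡ (∑-last n (λ k → g (suc k)))) (sym (+-assoc _ _ _))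

    ∑-thirds : ∀ n g → ∑< (n ℕ.* 3) g ≈
      ∑< n (λ k → g (k ℕ.* 3)) + (∑< n (λ k → g (1 ℕ.+ k ℕ.* 3)) + ∑< n (λ k → g (2 ℕ.+ k ℕ.* 3)))
    ∑-thirds zero    g = sym (trans (+-identityˡ _) (+-identityˡ _))
    ∑-thirds (suc n) g = begin
      g 0 + (g 1 + (g 2 + ∑< (n ℕ.* 3) (λ k → g (3 ℕ.+ k))))
        ≈⟨ +-congˡ (+-congˡ (+-congˡ (∑-thirds n (λ k → g (3 ℕ.+ k))))) ⟩
      g 0 + (g 1 + (g 2 + (_ + (_ + _))))
        ≈⟨ solve 6 (λ a b c x y z → a :+ (b :+ (c :+ (x :+ (y :+ z)))) := (a :+ x) :+ ((b :+ y) :+ (c :+ z)))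
             refl (g 0) (g 1) (g 2) _ _ _ ⟩
      _ ∎

  ∑-cong : ∀ n {g h} → (∀ k → g k ≈ h k) → ∑< n g ≈ ∑< n h
  ∑-cong n g≈h = ∑-cong-< n λ k _ → g≈h k

  -- P m u p = (-u; p)_m
  P : ℕ → Carrier → Carrier → Carrier
  P zero    u p = 1#
  P (suc m) u p = P m u p * (1# + u * p ^ m)

  P-cong : ∀ m {u u′ p p′} → u ≈ u′ → p ≈ p′ → P m u p ≈ P m u′ p′
  P-cong zero    u≈ p≈ = refl
  P-cong (suc m) u≈ p≈ = *-cong (P-cong m u≈ p≈) (+-congˡ (*-cong u≈ (^-congˡ m p≈)))

  P-head : ∀ m u p → P (suc m) u p ≈ (1# + u) * P m (u * p) p
  P-head zero    u p = solve 1 (λ u → con 1 :* (con 1 :+ u :* con 1) := (con 1 :+ u) :* con 1) refl u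
  P-head (suc m) u p = begin
    P (suc m) u p * (1# + u * (p * p ^ m))                    ≈⟨ *-congʳ (P-head m u p) ⟩
    (1# + u) * P m (u * p) p * (1# + u * (p * p ^ m))
      ≈⟨ solve 4 (λ u p z y → (con 1 :+ u) :* z :* (con 1 :+ u :* (p :* y))
                            := (con 1 :+ u) :* (z :* (con 1 :+ u :* p :* y))) refl u p _ _ ⟩
    (1# + u) * (P m (u * p) p * (1# + u * p * p ^ m))         ∎

  ^-*-assoc : ∀ p j m {k} → j ℕ.* m ≡ k → (p ^ j) ^ m ≈ p ^ k
  ^-*-assoc p j m eq = trans (^-assocʳ p j m) (^-congʳ p eq)

  P-halves : ∀ m u p → P (m ℕ.* 2) u p ≈ P m u (p ^ 2) * P m (u * p) (p ^ 2)
  P-halves zero    u p = sym (*-identityˡ 1#)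
  P-halves (suc m) u p = begin
    P (m ℕ.* 2) u p * (1# + u * p ^ (m ℕ.* 2)) * (1# + u * (p * p ^ (m ℕ.* 2)))
      ≈⟨ *-congʳ (*-congʳ (P-halves m u p)) ⟩
    _ * _ * (1# + u * p ^ (m ℕ.* 2)) * (1# + u * (p * p ^ (m ℕ.* 2)))
      ≈⟨ solve 5 (λ a b u p y → a :* b :* (con 1 :+ u :* y) :* (con 1 :+ u :* (p :* y))
                   := a :* (con 1 :+ u :* y) :* (b :* (con 1 :+ u :* p :* y))) refl _ _ u p _ ⟩
    P m u (p ^ 2) * (1# + u * p ^ (m ℕ.* 2)) * (P m (u * p) (p ^ 2) * (1# + u * p * p ^ (m ℕ.* 2)))
      ≈⟨ *-cong (*-congˡ (+-congˡ (*-congˡ (sym p²)))) (*-congˡ (+-congˡ (*-congˡ (sym p²)))) ⟩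
    _ ∎
    where
    p² : (p ^ 2) ^ m ≈ p ^ (m ℕ.* 2)
    p² = ^-*-assoc p 2 m (ℕ.*-comm 2 m)

  P-thirds : ∀ m u p → P (m ℕ.* 3) u p ≈ P m u (p ^ 3) * P m (u * p) (p ^ 3) * P m (u * p ^ 2) (p ^ 3)
  P-thirds zero    u p = sym (trans (*-identityʳ _) (*-identityˡ 1#))
  P-thirds (suc m) u p = begin
    P (m ℕ.* 3) u p * (1# + u * y) * (1# + u * (p * y)) * (1# + u * (p * (p * y)))
      ≈⟨ *-congʳ (*-congʳ (*-congʳ (P-thirds m u p))) ⟩
    _ * _ * _ * (1# + u * y) * (1# + u * (p * y)) * (1# + u * (p * (p * y)))
      ≈⟨ solve 6 (λ a b c u p y →
           a :* b :* c :* (con 1 :+ u :* y) :* (con 1 :+ u :* (p :* y)) :* (con 1 :+ u :* (p :* (p :* y)))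
           := a :* (con 1 :+ u :* y) :* (b :* (con 1 :+ u :* p :* y)) :* (c :* (con 1 :+ u :* p :^ 2 :* y)))
           refl _ _ _ u p y ⟩
    P m u (p ^ 3) * (1# + u * y) * (P m (u * p) (p ^ 3) * (1# + u * p * y))
      * (P m (u * p ^ 2) (p ^ 3) * (1# + u * p ^ 2 * y))
      ≈⟨ *-cong (*-cong (*-congˡ (+-congˡ (*-congˡ p³))) (*-congˡ (+-congˡ (*-congˡ p³))))
           (*-congˡ (+-congˡ (*-congˡ p³))) ⟩
    _ ∎
    where
    y : Carrier
    y = p ^ (m ℕ.* 3)
    p³ : y ≈ (p ^ 3) ^ m
    p³ = sym (^-*-assoc p 3 m (ℕ.*-comm 3 m))

  -- Factor by factor, 1 - z² = (1 + z) (1 - z) with z = u p^i.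
  P-square : ∀ m u p → P m (-1# * u ^ 2) (p ^ 2) ≈ P m u p * P m (-1# * u) p
  P-square zero    u p = sym (*-identityˡ 1#)
  P-square (suc m) u p = begin
    P m (-1# * u ^ 2) (p ^ 2) * (1# + -1# * u ^ 2 * (p ^ 2) ^ m)
      ≈⟨ *-cong (P-square m u p) (+-congˡ (*-congˡ (trans (^-*-assoc p 2 m (ℕ.*-comm 2 m)) (sym (^-assocʳ p m 2))))) ⟩
    _ * _ * (1# + -1# * u ^ 2 * (p ^ m) ^ 2)
      -- Adds a zero multiple of z, because (1 + z) (1 + e z) = 1 + e z² + (1 + e) z holds for every
      -- e.
      ≈⟨ *-congˡ (cancel-1 _ (u * p ^ m)) ⟨
    _ * _ * (1# + -1# * u ^ 2 * (p ^ m) ^ 2 + (1# + -1#) * (u * p ^ m))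
      ≈⟨ solve 5 (λ a b e u y → a :* b :* (con 1 :+ e :* u :^ 2 :* y :^ 2 :+ (con 1 :+ e) :* (u :* y))
                   := a :* (con 1 :+ u :* y) :* (b :* (con 1 :+ e :* u :* y))) refl _ _ -1# u _ ⟩
    _ ∎

  -- g₃ m u p = (u³; p³)_m / (u; p)_m
  g₃ : ℕ → Carrier → Carrier → Carrier
  g₃ zero    u p = 1#
  g₃ (suc m) u p = g₃ m u p * (1# + (u * p ^ m + (u * p ^ m) ^ 2))

  -- Factor by factor, 1 - z³ = (1 - z) (1 + z + z²). The quotient `g₃` is thereby free of
  -- subtraction.
  P-cube : ∀ m u p → P m (-1# * u ^ 3) (p ^ 3) ≈ P m (-1# * u) p * g₃ m u p
  P-cube zero    u p = sym (*-identityˡ 1#)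
  P-cube (suc m) u p = begin
    P m (-1# * u ^ 3) (p ^ 3) * (1# + -1# * u ^ 3 * (p ^ 3) ^ m)
      ≈⟨ *-cong (P-cube m u p) (+-congˡ (*-congˡ (trans (^-*-assoc p 3 m (ℕ.*-comm 3 m)) (sym (^-assocʳ p m 3))))) ⟩
    _ * _ * (1# + -1# * u ^ 3 * (p ^ m) ^ 3)
      ≈⟨ *-congˡ (cancel-1 _ (u * p ^ m + (u * p ^ m) ^ 2)) ⟨
    _ * _ * (1# + -1# * u ^ 3 * (p ^ m) ^ 3 + (1# + -1#) * (u * p ^ m + (u * p ^ m) ^ 2))
      ≈⟨ solve 5 (λ a b e u y → a :* b :* (con 1 :+ e :* u :^ 3 :* y :^ 3 :+ (con 1 :+ e) :* (u :* y :+ (u :* y) :^ 2))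
                   := a :* (con 1 :+ e :* u :* y) :* (b :* (con 1 :+ (u :* y :+ (u :* y) :^ 2)))) refl _ _ -1# u _ ⟩
    _ ∎

  -- The geometric sum 1 + x + ... + x^(m-1) in Horner form. It inverts 1 - x as soon as x^m
  -- vanishes.
  geo : ℕ → Carrier → Carrier
  geo zero    x = 0#
  geo (suc m) x = 1# + x * geo m x

  geo-sum : ∀ m x → (1# + -1# * x) * geo m x + x ^ m ≈ 1#
  geo-sum zero    x = trans (+-congʳ (zeroʳ _)) (+-identityˡ 1#)
  geo-sum (suc m) x = begin
    (1# + -1# * x) * (1# + x * geo m x) + x * x ^ m
      ≈⟨ solve 4 (λ e x g y → (con 1 :+ e :* x) :* (con 1 :+ x :* g) :+ x :* y
                   := con 1 :+ e :* x :+ x :* ((con 1 :+ e :* x) :* g :+ y)) refl -1# x _ _ ⟩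
    1# + -1# * x + x * ((1# + -1# * x) * geo m x + x ^ m)   ≈⟨ +-congˡ (*-congˡ (geo-sum m x)) ⟩
    1# + -1# * x + x * 1#
      ≈⟨ solve 2 (λ e x → con 1 :+ e :* x :+ x :* con 1 := con 1 :+ (con 1 :+ e) :* x) refl -1# x ⟩
    1# + (1# + -1#) * x                                     ≈⟨ cancel-1 1# x ⟩
    1#                                                      ∎

  Unit : Carrier → Set _
  Unit x = ∃ λ y → x * y ≈ 1#

  Unit-* : ∀ {x y} → Unit x → Unit y → Unit (x * y)
  Unit-* {x} {y} (x′ , xx′) (y′ , yy′) = x′ * y′ , (begin
    x * y * (x′ * y′)    ≈⟨ solve 4 (λ x y x′ y′ → x :* y :* (x′ :* y′) := (x :* x′) :* (y :* y′)) refl x y x′ y′ ⟩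
    (x * x′) * (y * y′)  ≈⟨ *-cong xx′ yy′ ⟩
    1# * 1#              ≈⟨ *-identityˡ 1# ⟩
    1#                   ∎)

  Unit-cancel : ∀ {z} → Unit z → ∀ x y → z * x ≈ z * y → x ≈ y
  Unit-cancel {z} (z′ , zz′) x y zx≈zy = begin
    x              ≈⟨ unfold x ⟩
    z′ * (z * x)   ≈⟨ *-congˡ zx≈zy ⟩
    z′ * (z * y)   ≈⟨ unfold y ⟨
    y              ∎
    where
    unfold : ∀ w → w ≈ z′ * (z * w)
    unfold w = begin
      w              ≈⟨ *-identityˡ w ⟨
      1# * w         ≈⟨ *-congʳ zz′ ⟨
      z * z′ * w     ≈⟨ solve 3 (λ z z′ w → z :* z′ :* w := z′ :* (z :* w)) refl z z′ w ⟩
      z′ * (z * w)   ∎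

  -- Gaussian binomial coefficients by Pascal's rule

  binom : Carrier → ℕ → ℕ → Carrier
  binom p m       zero    = 1#
  binom p zero    (suc k) = 0#
  binom p (suc m) (suc k) = binom p m k + p ^ suc k * binom p m (suc k)

  binom-zero : ∀ p {m k} → m < k → binom p m k ≈ 0#
  binom-zero p {zero}  {suc k} _         = refl
  binom-zero p {suc m} {suc k} (s≤s m<k) = begin
    binom p m k + p ^ suc k * binom p m (suc k)
      ≈⟨ +-cong (binom-zero p m<k) (*-congˡ (binom-zero p (ℕ.m<n⇒m<1+n m<k))) ⟩
    0# + p ^ suc k * 0#  ≈⟨ trans (+-identityˡ _) (zeroʳ _) ⟩
    0#                   ∎

  -- This is (p; p)_m, with factors 1 - p^(i+1).
  E : ℕ → Carrier → Carrier
  E m p = P m (-1# * p) p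

  -- Induction along Pascal's rule: after the common factor (p; p)_m is taken out, the two summands
  -- combine by (1 - p^(a+1)) + p^(a+1) (1 - p^(b+1)) = 1 - p^(a+b+2).
  binom-factorial : ∀ p m a b → a ℕ.+ b ≡ m → binom p m a * (E a p * E b p) ≈ E m p
  binom-factorial p m       zero    b       ≡.refl = trans (*-identityˡ _) (*-identityˡ _)
  binom-factorial p (suc m) (suc a) zero    eq     = begin
    (binom p m a + p ^ suc a * binom p m (suc a)) * (E (suc a) p * 1#)
      ≈⟨ *-cong (+-congˡ (*-congˡ (binom-zero p m<1+a))) (*-identityʳ _) ⟩
    (binom p m a + p ^ suc a * 0#) * E (suc a) p
      ≈⟨ solve 4 (λ x y z w → (x :+ y :* con 0) :* (z :* w) := x :* (z :* con 1) :* w) refl _ (p ^ suc a) (E a p) _ ⟩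
    binom p m a * (E a p * 1#) * (1# + -1# * p * p ^ a)
      ≈⟨ *-cong (binom-factorial p m a zero eq′) (+-congˡ (*-congˡ (^-congʳ p (≡.trans (≡.sym (ℕ.+-identityʳ a)) eq′)))) ⟩
    E m p * (1# + -1# * p * p ^ m) ∎
    where
    eq′ : a ℕ.+ 0 ≡ m
    eq′ = ℕ.suc-injective eq
    m<1+a : m < suc a
    m<1+a = s≤s (ℕ.≤-reflexive (≡.trans (≡.sym eq′) (ℕ.+-identityʳ a)))
  binom-factorial p (suc m) (suc a) (suc b) eq     = begin
    (x + p * p ^ a * y) * (E a p * (1# + -1# * p * p ^ a) * (E b p * (1# + -1# * p * p ^ b)))
      ≈⟨ solve 8 (λ x y A B e p α β →
           (x :+ p :* α :* y) :* (A :* (con 1 :+ e :* p :* α) :* (B :* (con 1 :+ e :* p :* β)))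
           := x :* (A :* (B :* (con 1 :+ e :* p :* β))) :* (con 1 :+ e :* p :* α)
              :+ p :* α :* (con 1 :+ e :* p :* β) :* (y :* (A :* (con 1 :+ e :* p :* α) :* B)))
           refl x y (E a p) (E b p) -1# p (p ^ a) (p ^ b) ⟩
    x * (E a p * E (suc b) p) * (1# + -1# * p * p ^ a)
      + p * p ^ a * (1# + -1# * p * p ^ b) * (y * (E (suc a) p * E b p))
      ≈⟨ +-cong (*-congʳ (binom-factorial p m a (suc b) eq₁)) (*-congˡ (binom-factorial p m (suc a) b eq₂)) ⟩
    E m p * (1# + -1# * p * p ^ a) + p * p ^ a * (1# + -1# * p * p ^ b) * E m p
      ≈⟨ solve 5 (λ M e p α β →
           M :* (con 1 :+ e :* p :* α) :+ p :* α :* (con 1 :+ e :* p :* β) :* M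
           := M :* (con 1 :+ e :* p :* (p :* α :* β)) :+ (con 1 :+ e) :* (p :* α :* M))
           refl (E m p) -1# p (p ^ a) (p ^ b) ⟩
    E m p * (1# + -1# * p * (p ^ suc a * p ^ b)) + (1# + -1#) * (p * p ^ a * E m p)  ≈⟨ cancel-1 _ _ ⟩
    E m p * (1# + -1# * p * (p ^ suc a * p ^ b))
      ≈⟨ *-congˡ (+-congˡ (*-congˡ (trans (sym (^-homo-* p (suc a) b)) (^-congʳ p eq₂)))) ⟩
    E m p * (1# + -1# * p * p ^ m) ∎
    where
    x y : Carrier
    x = binom p m a
    y = binom p m (suc a)
    eq₁ : a ℕ.+ suc b ≡ m
    eq₁ = ℕ.suc-injective eq
    eq₂ : suc a ℕ.+ b ≡ m
    eq₂ = ≡.trans (≡.sym (ℕ.+-suc a b)) eq₁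

  -- The q-binomial theorem and the finite triple product

  binomSum : Carrier → ℕ → (ℕ → Carrier) → Carrier
  binomSum p m t = ∑< (suc m) (λ k → t k * binom p m k)

  binomSum-cong : ∀ p m {s t} → (∀ k → s k ≈ t k) → binomSum p m s ≈ binomSum p m t
  binomSum-cong p m s≈t = ∑-cong (suc m) λ k → *-congʳ (s≈t k)

  binomSum-* : ∀ p m x t → binomSum p m (λ k → x * t k) ≈ x * binomSum p m t
  binomSum-* p m x t = trans (∑-cong (suc m) λ k → *-assoc x (t k) _) (∑-* (suc m) x _)

  -- Pascal's rule splits each summand with k > 0. The first halves give the shifted sum; the second
  -- halves, completed by the summand k = 0, give the other.
  binomSum-pascal : ∀ p m t →
    binomSum p (suc m) t ≈ binomSum p m (λ k → t (suc k)) + binomSum p m (λ k → p ^ k * t k)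
  binomSum-pascal p m t = begin
    binomSum p (suc m) t  ≈⟨ ∑-first (suc m) _ ⟩
    t 0 * 1# + ∑< (suc m) (λ k → t (suc k) * (binom p m k + p ^ suc k * binom p m (suc k)))
      ≈⟨ +-congˡ (trans (∑-cong (suc m) λ k →
           solve 4 (λ t x y z → t :* (x :+ y :* z) := t :* x :+ y :* t :* z) refl (t (suc k)) _ (p ^ suc k) _)
           (∑-+ (suc m) _ _)) ⟩
    t 0 * 1# + (binomSum p m (λ k → t (suc k)) + ∑< (suc m) (λ k → p ^ suc k * t (suc k) * binom p m (suc k)))
      ≈⟨ solve 3 (λ t x y → t :* con 1 :+ (x :+ y) := x :+ (con 1 :* t :* con 1 :+ y)) refl (t 0) _ _ ⟩
    binomSum p m (λ k → t (suc k)) + _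
      ≈⟨ +-congˡ (∑-first (suc m) (λ k → p ^ k * t k * binom p m k)) ⟨
    binomSum p m (λ k → t (suc k)) + ∑< (suc (suc m)) (λ k → p ^ k * t k * binom p m k)
      ≈⟨ +-congˡ (∑-last (suc m) _) ⟩
    binomSum p m (λ k → t (suc k)) + (binomSum p m (λ k → p ^ k * t k) + p ^ suc m * t (suc m) * binom p m (suc m))
      -- The second sum runs up to k = m + 1, where the binomial coefficient is 0.
      ≈⟨ +-congˡ (trans (+-congˡ (trans (*-congˡ (binom-zero p (ℕ.n<1+n m))) (zeroʳ _))) (+-identityʳ _)) ⟩
    binomSum p m (λ k → t (suc k)) + binomSum p m (λ k → p ^ k * t k) ∎

  -- τ u p j = u^j p^(j(j-1)/2)
  τ : Carrier → Carrier → ℕ → Carrier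
  τ u p zero    = 1#
  τ u p (suc j) = τ u p j * (u * p ^ j)

  τ-shift : ∀ u p j → p ^ j * τ u p j ≈ τ (u * p) p j
  τ-shift u p zero    = *-identityˡ 1#
  τ-shift u p (suc j) = begin
    p * p ^ j * (τ u p j * (u * p ^ j))
      ≈⟨ solve 4 (λ u p t y → p :* y :* (t :* (u :* y)) := y :* t :* (u :* p :* y)) refl u p _ _ ⟩
    p ^ j * τ u p j * (u * p * p ^ j)   ≈⟨ *-congʳ (τ-shift u p j) ⟩
    τ (u * p) p j * (u * p * p ^ j)     ∎

  -- Taking off the factor 1 + u leaves the product at u p, with terms p^k `τ u p k`. Its multiples
  -- by u and by 1 are the two sums of `binomSum-pascal`.
  q-binomial : ∀ m u p → P m u p ≈ binomSum p m (τ u p)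
  q-binomial zero    u p = sym (trans (∑-first 0 _) (trans (+-cong (*-identityˡ 1#) (∑-zero _)) (+-identityʳ 1#)))
  q-binomial (suc m) u p = begin
    P (suc m) u p                     ≈⟨ P-head m u p ⟩
    (1# + u) * P m (u * p) p          ≈⟨ *-congˡ (q-binomial m (u * p) p) ⟩
    (1# + u) * S                      ≈⟨ solve 2 (λ u s → (con 1 :+ u) :* s := u :* s :+ s) refl u S ⟩
    u * S + S                         ≈⟨ +-congʳ (binomSum-* p m u _) ⟨
    binomSum p m (λ k → u * τ (u * p) p k) + S
      ≈⟨ +-cong (binomSum-cong p m shift) (binomSum-cong p m λ k → sym (τ-shift u p k)) ⟩
    binomSum p m (λ k → τ u p (suc k)) + binomSum p m (λ k → p ^ k * τ u p k)
      ≈⟨ binomSum-pascal p m (τ u p) ⟨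
    binomSum p (suc m) (τ u p)        ∎
    where
    S : Carrier
    S = binomSum p m (τ (u * p) p)
    shift : ∀ k → u * τ (u * p) p k ≈ τ u p (suc k)
    shift k = begin
      u * τ (u * p) p k       ≈⟨ *-congˡ (τ-shift u p k) ⟨
      u * (p ^ k * τ u p k)   ≈⟨ solve 3 (λ u y t → u :* (y :* t) := t :* (u :* y)) refl u _ _ ⟩
      τ u p k * (u * p ^ k)   ∎

  -- The term of index j = k - n of Σ_j u^(j(j+1)/2) v^(j(j-1)/2), where p = u v.
  θ : Carrier → Carrier → Carrier → ℕ → ℕ → Carrier
  θ u v p k       zero    = τ u p k
  θ u v p zero    (suc n) = τ v p (suc n)
  θ u v p (suc k) (suc n) = θ u v p k n

  -- With j = k - n, term j is u^j v^(j-1) times term j - 1, and v p^n u^j v^(j-1) = p^(n+j) = p^k.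
  -- The recursion on k and n avoids negative exponents.
  θ-step : ∀ {u v p} → u * v ≈ p → ∀ k n → v * p ^ n * θ u v p k n ≈ p ^ k * θ u v p k (suc n)
  θ-step {u} {v} {p} uv≈p zero zero =
    solve 1 (λ v → v :* con 1 :* con 1 := con 1 :* (con 1 :* (v :* con 1))) refl v
  θ-step {u} {v} {p} uv≈p zero (suc n) =
    solve 3 (λ v y t → v :* y :* t := con 1 :* (t :* (v :* y))) refl v (p ^ suc n) (τ v p (suc n))
  θ-step {u} {v} {p} uv≈p (suc k) zero = begin
    v * 1# * (τ u p k * (u * p ^ k))
      ≈⟨ solve 4 (λ u v t y → v :* con 1 :* (t :* (u :* y)) := u :* v :* y :* t) refl u v _ _ ⟩
    u * v * p ^ k * τ u p k           ≈⟨ *-congʳ (*-congʳ uv≈p) ⟩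
    p * p ^ k * τ u p k               ∎
  θ-step {u} {v} {p} uv≈p (suc k) (suc n) = begin
    v * (p * p ^ n) * θ u v p k n
      ≈⟨ solve 4 (λ v p y t → v :* (p :* y) :* t := p :* (v :* y :* t)) refl v p _ _ ⟩
    p * (v * p ^ n * θ u v p k n)          ≈⟨ *-congˡ (θ-step uv≈p k n) ⟩
    p * (p ^ k * θ u v p k (suc n))        ≈⟨ *-assoc p _ _ ⟨
    p * p ^ k * θ u v p k (suc n)          ∎

  -- Induction on n: the new factor 1 + v p^n produces two sums, which `θ-step` turns into the two
  -- sums of Pascal's rule for n + 1. The case n = 0 is the q-binomial theorem.
  finite-triple-product : ∀ {u v p} → u * v ≈ p → ∀ m n →
    P m u p * P n v p ≈ binomSum p (n ℕ.+ m) (λ k → θ u v p k n)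
  finite-triple-product {u} {v} {p} uv≈p m zero    = trans (*-identityʳ _) (q-binomial m u p)
  finite-triple-product {u} {v} {p} uv≈p m (suc n) = begin
    P m u p * (P n v p * (1# + v * p ^ n))
      ≈⟨ solve 4 (λ a b v y → a :* (b :* (con 1 :+ v :* y)) := a :* b :+ v :* y :* (a :* b)) refl _ _ v _ ⟩
    P m u p * P n v p + v * p ^ n * (P m u p * P n v p)
      ≈⟨ +-cong IH (trans (*-congˡ IH) (sym (binomSum-* p M (v * p ^ n) _))) ⟩
    binomSum p M (λ k → θ u v p k n) + binomSum p M (λ k → v * p ^ n * θ u v p k n)
      ≈⟨ +-congˡ (binomSum-cong p M λ k → θ-step uv≈p k n) ⟩
    binomSum p M (λ k → θ u v p k n) + binomSum p M (λ k → p ^ k * θ u v p k (suc n))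
      -- By definition `θ u v p k n` is `θ u v p (suc k) (suc n)`, so the first sum is the shifted
      -- one.
      ≈⟨ binomSum-pascal p M (λ k → θ u v p k (suc n)) ⟨
    binomSum p (suc M) (λ k → θ u v p k (suc n)) ∎
    where
    M : ℕ
    M = n ℕ.+ m
    IH : P m u p * P n v p ≈ binomSum p M (λ k → θ u v p k n)
    IH = finite-triple-product uv≈p m n

  -- Theta sums and their dissection modulo 3

  thetaSum : ℕ → Carrier → Carrier → Carrier → Carrier
  thetaSum n u v p = ∑< n (τ u p) + ∑< n (λ j → τ v p (suc j))

  -- The index k stands for j = k - n, which runs over -n ≤ j < m. The negative j contribute the sum
  -- with v.
  ∑-θ : ∀ u v p n m → ∑< (n ℕ.+ m) (λ k → θ u v p k n) ≈ ∑< m (τ u p) + ∑< n (λ j → τ v p (suc j))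
  ∑-θ u v p zero    m = sym (trans (+-congˡ (∑-zero _)) (+-identityʳ _))
  ∑-θ u v p (suc n) m = begin
    ∑< (suc n ℕ.+ m) (λ k → θ u v p k (suc n))                         ≈⟨ ∑-first (n ℕ.+ m) _ ⟩
    τ v p (suc n) + ∑< (n ℕ.+ m) (λ k → θ u v p k n)                   ≈⟨ +-congˡ (∑-θ u v p n m) ⟩
    τ v p (suc n) + (∑< m (τ u p) + ∑< n (λ j → τ v p (suc j)))
      ≈⟨ solve 3 (λ x y z → x :+ (y :+ z) := y :+ (z :+ x)) refl _ _ _ ⟩
    ∑< m (τ u p) + (∑< n (λ j → τ v p (suc j)) + τ v p (suc n))        ≈⟨ +-congˡ (∑-last n _) ⟨
    ∑< m (τ u p) + ∑< (suc n) (λ j → τ v p (suc j))                    ∎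

  τ-thirds-ratio : ∀ p k → (p ^ 9) ^ k ≈ (p ^ (k ℕ.* 3)) ^ 3
  τ-thirds-ratio p k = trans (^-*-assoc p 9 k (9k≡ k)) (sym (^-assocʳ p (k ℕ.* 3) 3))
    where
    9k≡ : ∀ k → 9 ℕ.* k ≡ k ℕ.* 3 ℕ.* 3
    9k≡ = solve-∀

  -- Three consecutive ratios of τ multiply to a³ p³ y³ with y = p^(3k), so each step in k gains a
  -- factor p⁹.
  τ-third₀ : ∀ a p k → τ a p (k ℕ.* 3) ≈ τ (a ^ 3 * p ^ 3) (p ^ 9) k
  τ-third₀ a p zero    = refl
  τ-third₀ a p (suc k) = begin
    τ a p (k ℕ.* 3) * (a * y) * (a * (p * y)) * (a * (p * (p * y)))
      ≈⟨ solve 4 (λ t a p y → t :* (a :* y) :* (a :* (p :* y)) :* (a :* (p :* (p :* y)))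
           := t :* (a :^ 3 :* p :^ 3 :* y :^ 3)) refl _ a p y ⟩
    τ a p (k ℕ.* 3) * (a ^ 3 * p ^ 3 * y ^ 3)
      ≈⟨ *-cong (τ-third₀ a p k) (*-congˡ (sym (τ-thirds-ratio p k))) ⟩
    _ ∎
    where
    y : Carrier
    y = p ^ (k ℕ.* 3)

  τ-third₁ : ∀ a p k → τ a p (1 ℕ.+ k ℕ.* 3) ≈ a * τ (a ^ 3 * p ^ 6) (p ^ 9) k
  τ-third₁ a p zero    = solve 1 (λ a → con 1 :* (a :* con 1) := a :* con 1) refl a
  τ-third₁ a p (suc k) = begin
    τ a p (1 ℕ.+ k ℕ.* 3) * (a * (p * y)) * (a * (p * (p * y))) * (a * (p * (p * (p * y))))
      ≈⟨ *-congʳ (*-congʳ (*-congʳ (τ-third₁ a p k))) ⟩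
    a * _ * (a * (p * y)) * (a * (p * (p * y))) * (a * (p * (p * (p * y))))
      ≈⟨ solve 4 (λ t a p y → a :* t :* (a :* (p :* y)) :* (a :* (p :* (p :* y))) :* (a :* (p :* (p :* (p :* y))))
           := a :* (t :* (a :^ 3 :* p :^ 6 :* y :^ 3))) refl _ a p y ⟩
    a * (_ * (a ^ 3 * p ^ 6 * y ^ 3))   ≈⟨ *-congˡ (*-congˡ (*-congˡ (τ-thirds-ratio p k))) ⟨
    _ ∎
    where
    y : Carrier
    y = p ^ (k ℕ.* 3)

  -- As 3k + 2 = 3 (k + 1) - 1, the term is taken relative to the index -1, whose term is b. For k =
  -- 0 this reads a² p = a³ b, from a b = p.
  τ-third₂ : ∀ {a b p} → a * b ≈ p → ∀ k → τ a p (2 ℕ.+ k ℕ.* 3) ≈ b * τ (a ^ 3) (p ^ 9) (suc k)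
  τ-third₂ {a} {b} {p} ab≈p zero    = begin
    1# * (a * 1#) * (a * (p * 1#))
      ≈⟨ solve 2 (λ a p → con 1 :* (a :* con 1) :* (a :* (p :* con 1)) := a :^ 2 :* p) refl a p ⟩
    a ^ 2 * p         ≈⟨ *-congˡ ab≈p ⟨
    a ^ 2 * (a * b)   ≈⟨ solve 2 (λ a b → a :^ 2 :* (a :* b) := b :* (con 1 :* (a :^ 3 :* con 1))) refl a b ⟩
    _                 ∎
  τ-third₂ {a} {b} {p} ab≈p (suc k) = begin
    τ a p (2 ℕ.+ k ℕ.* 3) * (a * (p * (p * y))) * (a * (p * (p * (p * y)))) * (a * (p * (p * (p * (p * y)))))
      ≈⟨ *-congʳ (*-congʳ (*-congʳ (τ-third₂ ab≈p k))) ⟩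
    b * _ * (a * (p * (p * y))) * (a * (p * (p * (p * y)))) * (a * (p * (p * (p * (p * y)))))
      ≈⟨ solve 5 (λ b t a p y →
           b :* t :* (a :* (p :* (p :* y))) :* (a :* (p :* (p :* (p :* y)))) :* (a :* (p :* (p :* (p :* (p :* y)))))
           := b :* (t :* (a :^ 3 :* (p :^ 9 :* y :^ 3)))) refl b _ a p y ⟩
    b * (_ * (a ^ 3 * (p ^ 9 * y ^ 3)))   ≈⟨ *-congˡ (*-congˡ (*-congˡ (*-congˡ (τ-thirds-ratio p k)))) ⟨
    _ ∎
    where
    y : Carrier
    y = p ^ (k ℕ.* 3)

  -- The indices -3n ≤ j < 3n fall into the classes 3k, 3k + 1 and -3k - 1, each with -n ≤ k < n.
  -- The last class is read backwards, which exchanges a and b in it.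
  thetaSum-thirds : ∀ {a b p} → a * b ≈ p → ∀ n →
    thetaSum (n ℕ.* 3) a b p ≈
      thetaSum n (a ^ 3 * p ^ 3) (b ^ 3 * p ^ 3) (p ^ 9)
      + (a * thetaSum n (a ^ 3 * p ^ 6) (b ^ 3) (p ^ 9) + b * thetaSum n (b ^ 3 * p ^ 6) (a ^ 3) (p ^ 9))
  thetaSum-thirds {a} {b} {p} ab≈p n = begin
    thetaSum (n ℕ.* 3) a b p  ≈⟨ +-cong (∑-thirds n (τ a p)) (∑-thirds n (λ j → τ b p (suc j))) ⟩
    _ + (_ + _) + (_ + (_ + _))
      ≈⟨ +-cong
           (+-cong (∑-cong n (τ-third₀ a p))
             (+-cong (trans (∑-cong n (τ-third₁ a p)) (∑-* n a _))
                     (trans (∑-cong n (τ-third₂ ab≈p)) (∑-* n b _))))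
           (+-cong (trans (∑-cong n (τ-third₁ b p)) (∑-* n b _))
             (+-cong (trans (∑-cong n (τ-third₂ (trans (*-comm b a) ab≈p))) (∑-* n a _))
                     (∑-cong n (λ k → τ-third₀ b p (suc k))))) ⟩
    A₀ + (a * A₁ + b * A₂) + (b * B₁ + (a * B₂ + B₀))
      ≈⟨ solve 8 (λ a b A₀ A₁ A₂ B₀ B₁ B₂ →
           A₀ :+ (a :* A₁ :+ b :* A₂) :+ (b :* B₁ :+ (a :* B₂ :+ B₀))
           := (A₀ :+ B₀) :+ (a :* (A₁ :+ B₂) :+ b :* (B₁ :+ A₂))) refl a b A₀ A₁ A₂ B₀ B₁ B₂ ⟩
    _ ∎
    where
    A₀ A₁ A₂ B₀ B₁ B₂ : Carrier
    A₀ = ∑< n (τ (a ^ 3 * p ^ 3) (p ^ 9))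
    A₁ = ∑< n (τ (a ^ 3 * p ^ 6) (p ^ 9))
    A₂ = ∑< n (λ j → τ (a ^ 3) (p ^ 9) (suc j))
    B₀ = ∑< n (λ j → τ (b ^ 3 * p ^ 3) (p ^ 9) (suc j))
    B₁ = ∑< n (τ (b ^ 3 * p ^ 6) (p ^ 9))
    B₂ = ∑< n (λ j → τ (b ^ 3) (p ^ 9) (suc j))

  -- In a ring with p^N = 0 the infinite products and theta series with base p are finite.
  module Nilpotent (N : ℕ) where

    -- Nilpotent elements, units and stable products

    Nil : Carrier → Set _
    Nil x = x ^ N ≈ 0#

    Nil-* : ∀ {x} y → Nil x → Nil (x * y)
    Nil-* {x} y x^N≈0 = trans (^-distrib-* x y N) (trans (*-congʳ x^N≈0) (zeroˡ _))

    ^-vanish : ∀ {p m} → Nil p → N ≤ m → p ^ m ≈ 0#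
    ^-vanish {p} {m} p^N≈0 N≤m = begin
      p ^ m                     ≡⟨ ≡.cong (p ^_) (ℕ.m+[n∸m]≡n N≤m) ⟨
      p ^ (N ℕ.+ (m ℕ.∸ N))     ≈⟨ ^-homo-* p N (m ℕ.∸ N) ⟩
      p ^ N * p ^ (m ℕ.∸ N)     ≈⟨ trans (*-congʳ p^N≈0) (zeroˡ _) ⟩
      0#                        ∎

    -- Every factor of index i ≥ N is 1, as p^i = 0.
    P-stable : ∀ {p m} u → Nil p → N ≤ m → P m u p ≈ P N u p
    P-stable {p} {m} u p^N≈0 N≤m = begin
      P m u p                      ≡⟨ ≡.cong (λ m → P m u p) (ℕ.m∸n+n≡m N≤m) ⟨
      P (m ℕ.∸ N ℕ.+ N) u p        ≈⟨ go (m ℕ.∸ N) ⟩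
      P N u p                      ∎
      where
      go : ∀ d → P (d ℕ.+ N) u p ≈ P N u p
      go zero    = refl
      go (suc d) = begin
        P (d ℕ.+ N) u p * (1# + u * p ^ (d ℕ.+ N))
          ≈⟨ *-cong (go d) (+-congˡ (trans (*-congˡ (^-vanish p^N≈0 (ℕ.m≤n+m N d))) (zeroʳ u))) ⟩
        P N u p * (1# + 0#)  ≈⟨ trans (*-congˡ (+-identityʳ 1#)) (*-identityʳ _) ⟩
        P N u p              ∎

    Unit-1-x : ∀ {x} → Nil x → (1# + -1# * x) * geo N x ≈ 1#
    Unit-1-x {x} x^N≈0 = trans (sym (trans (+-congˡ x^N≈0) (+-identityʳ _))) (geo-sum N x)

    -- Each factor is 1 - x with x a multiple of u, hence nilpotent and inverted by a geometric sum.
    P-unit : ∀ m {u} p → Nil u → Unit (P m (-1# * u) p)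
    P-unit zero    p _ = 1# , *-identityˡ 1#
    P-unit (suc m) {u} p u^N≈0 = Unit-* (P-unit m p u^N≈0)
      (geo N (u * p ^ m) , trans (*-congʳ (+-congˡ (*-assoc _ _ _))) (Unit-1-x (Nil-* (p ^ m) u^N≈0)))

    -- Jacobi's triple product and its dissection

    P∞ : Carrier → Carrier → Carrier
    P∞ = P N

    E∞ : Carrier → Carrier
    E∞ = E N

    -- The last factor of `τ u p j` is u p^(j-1), hence the strict inequality.
    τ-vanish : ∀ {p j} u → Nil p → N < j → τ u p j ≈ 0#
    τ-vanish u p^N≈0 (s≤s N≤j) =
      trans (*-congˡ (trans (*-congˡ (^-vanish p^N≈0 N≤j)) (zeroʳ u))) (zeroʳ _)

    θ-vanish-< : ∀ {p} u v k n → Nil p → k ℕ.+ N < n → θ u v p k n ≈ 0#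
    θ-vanish-< u v zero    (suc n) p^N≈0 lt       = τ-vanish v p^N≈0 lt
    θ-vanish-< u v (suc k) (suc n) p^N≈0 (s≤s lt) = θ-vanish-< u v k n p^N≈0 lt

    θ-vanish-> : ∀ {p} u v k n → Nil p → n ℕ.+ N < k → θ u v p k n ≈ 0#
    θ-vanish-> u v k       zero    p^N≈0 lt       = τ-vanish u p^N≈0 lt
    θ-vanish-> u v (suc k) (suc n) p^N≈0 (s≤s lt) = θ-vanish-> u v k n p^N≈0 lt

    -- All three q-factorials in `binom-factorial` are equal to the unit `E∞ p` here, and one of
    -- them cancels.
    E-binom : ∀ {p a b} → Nil p → N ≤ a → N ≤ b → E∞ p * binom p (a ℕ.+ b) a ≈ 1#
    E-binom {p} {a} {b} p^N≈0 N≤a N≤b = Unit-cancel (P-unit N p p^N≈0) _ _ (begin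
      e * (e * β)              ≈⟨ solve 2 (λ e β → e :* (e :* β) := β :* (e :* e)) refl e β ⟩
      β * (e * e)              ≈⟨ *-congˡ (*-cong (P-stable _ p^N≈0 N≤a) (P-stable _ p^N≈0 N≤b)) ⟨
      β * (E a p * E b p)      ≈⟨ binom-factorial p (a ℕ.+ b) a b ≡.refl ⟩
      E (a ℕ.+ b) p            ≈⟨ P-stable _ p^N≈0 (ℕ.≤-trans N≤a (ℕ.m≤m+n a b)) ⟩
      e                        ≈⟨ *-identityʳ e ⟨
      e * 1#                   ∎)
      where
      e β : Carrier
      e = E∞ p
      β = binom p (a ℕ.+ b) a

    -- If k is further than N from n, the theta term is 0. Otherwise k and 2n - k are both at least
    -- N and `E-binom` applies.
    E-binom-θ : ∀ {p n k} u v → Nil p → N ℕ.+ N < n → k ≤ n ℕ.+ n →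
      θ u v p k n ≈ E∞ p * (θ u v p k n * binom p (n ℕ.+ n) k)
    E-binom-θ {p} {n} {k} u v p^N≈0 2N<n k≤2n with k ℕ.+ N ℕ.<? n | n ℕ.+ N ℕ.<? k
    ... | yes lt | _      = trans t≈0 (sym (trans (*-congˡ (trans (*-congʳ t≈0) (zeroˡ _))) (zeroʳ _)))
      where
      t≈0 : θ u v p k n ≈ 0#
      t≈0 = θ-vanish-< u v k n p^N≈0 lt
    ... | no _   | yes lt = trans t≈0 (sym (trans (*-congˡ (trans (*-congʳ t≈0) (zeroˡ _))) (zeroʳ _)))
      where
      t≈0 : θ u v p k n ≈ 0#
      t≈0 = θ-vanish-> u v k n p^N≈0 lt
    ... | no ≮₁  | no ≮₂  = sym (begin
      E∞ p * (t * binom p (n ℕ.+ n) k)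
        ≡⟨ ≡.cong (λ m → E∞ p * (t * binom p m k)) (ℕ.m+[n∸m]≡n k≤2n) ⟨
      E∞ p * (t * binom p (k ℕ.+ (n ℕ.+ n ℕ.∸ k)) k)
        ≈⟨ solve 3 (λ e t β → e :* (t :* β) := t :* (e :* β)) refl _ t _ ⟩
      t * (E∞ p * binom p (k ℕ.+ (n ℕ.+ n ℕ.∸ k)) k)
        ≈⟨ *-congˡ (E-binom p^N≈0 N≤k N≤2n∸k) ⟩
      t * 1#
        ≈⟨ *-identityʳ t ⟩
      t ∎)
      where
      t : Carrier
      t = θ u v p k n
      N≤k : N ≤ k
      N≤k = ℕ.+-cancelʳ-≤ N N k (ℕ.≤-trans (ℕ.<⇒≤ 2N<n) (ℕ.≮⇒≥ ≮₁))
      N≤2n∸k : N ≤ n ℕ.+ n ℕ.∸ k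
      N≤2n∸k = ℕ.m+n≤o⇒m≤o∸n N (N+k≤n+n {N} {n} (ℕ.≮⇒≥ ≮₂) (ℕ.<⇒≤ 2N<n))

    tripleProduct : Carrier → Carrier → Carrier → Carrier
    tripleProduct u v p = P∞ u p * P∞ v p * E∞ p

    -- Multiply the finite triple product with m = n by (p; p)_∞: each binomial coefficient then
    -- disappears or meets a theta term that is 0.
    jacobi-triple-product : ∀ {u v p} n → u * v ≈ p → Nil p → N ℕ.+ N < n →
      thetaSum n u v p ≈ tripleProduct u v p
    jacobi-triple-product {u} {v} {p} n uv≈p p^N≈0 2N<n = begin
      thetaSum n u v p
        -- The finite product has terms for -n ≤ j ≤ n, while `thetaSum` stops before j = n. The
        -- missing term is 0.
        ≈⟨ +-congʳ (trans (∑-last n (τ u p)) (trans (+-congˡ (τ-vanish u p^N≈0 N<n)) (+-identityʳ _))) ⟨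
      ∑< (suc n) (τ u p) + ∑< n (λ j → τ v p (suc j))             ≈⟨ ∑-θ u v p n (suc n) ⟨
      ∑< (n ℕ.+ suc n) (λ k → θ u v p k n)
        ≡⟨ ≡.cong (λ m → ∑< m (λ k → θ u v p k n)) (ℕ.+-suc n n) ⟩
      ∑< (suc (n ℕ.+ n)) (λ k → θ u v p k n)
        ≈⟨ ∑-cong-< (suc (n ℕ.+ n)) (λ { k (s≤s k≤2n) → E-binom-θ u v p^N≈0 2N<n k≤2n }) ⟩
      ∑< (suc (n ℕ.+ n)) (λ k → E∞ p * (θ u v p k n * binom p (n ℕ.+ n) k))  ≈⟨ ∑-* _ _ _ ⟩
      E∞ p * binomSum p (n ℕ.+ n) (λ k → θ u v p k n)             ≈⟨ *-comm _ _ ⟩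
      binomSum p (n ℕ.+ n) (λ k → θ u v p k n) * E∞ p             ≈⟨ *-congʳ (finite-triple-product uv≈p n n) ⟨
      P n u p * P n v p * E∞ p
        ≈⟨ *-congʳ (*-cong (P-stable u p^N≈0 (ℕ.<⇒≤ N<n)) (P-stable v p^N≈0 (ℕ.<⇒≤ N<n))) ⟩
      tripleProduct u v p ∎
      where
      N<n : N < n
      N<n = ℕ.≤-<-trans (ℕ.m≤m+n N N) 2N<n

    tripleProduct-cong : ∀ {u u′ v v′ p p′} → u ≈ u′ → v ≈ v′ → p ≈ p′ →
      tripleProduct u v p ≈ tripleProduct u′ v′ p′
    tripleProduct-cong u≈ v≈ p≈ =
      *-cong (*-cong (P-cong N u≈ p≈) (P-cong N v≈ p≈)) (P-cong N (*-congˡ p≈) p≈)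

    -- Pass to theta sums, split them modulo 3, and pass back: in each class the two parameters
    -- multiply to p⁹.
    tripleProduct-thirds : ∀ {a b p} → a * b ≈ p → Nil p →
      tripleProduct a b p ≈
        tripleProduct (a ^ 3 * p ^ 3) (b ^ 3 * p ^ 3) (p ^ 9)
        + (a * tripleProduct (a ^ 3 * p ^ 6) (b ^ 3) (p ^ 9) + b * tripleProduct (b ^ 3 * p ^ 6) (a ^ 3) (p ^ 9))
    tripleProduct-thirds {a} {b} {p} ab≈p p^N≈0 = begin
      tripleProduct a b p         ≈⟨ jacobi-triple-product (n ℕ.* 3) ab≈p p^N≈0 (ℕ.m≤m*n n 3) ⟨
      thetaSum (n ℕ.* 3) a b p    ≈⟨ thetaSum-thirds ab≈p n ⟩
      _ + (a * _ + b * _)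
        ≈⟨ +-cong (jtp (begin
             a ^ 3 * p ^ 3 * (b ^ 3 * p ^ 3)
               ≈⟨ solve 3 (λ a b p → a :^ 3 :* p :^ 3 :* (b :^ 3 :* p :^ 3) := (a :* b) :^ 3 :* p :^ 6) refl a b p ⟩
             (a * b) ^ 3 * p ^ 6   ≈⟨ cube ⟩
             p ^ 9                 ∎))
           (+-cong
             (*-congˡ (jtp (begin
               a ^ 3 * p ^ 6 * b ^ 3
                 ≈⟨ solve 3 (λ a b p → a :^ 3 :* p :^ 6 :* b :^ 3 := (a :* b) :^ 3 :* p :^ 6) refl a b p ⟩
               (a * b) ^ 3 * p ^ 6   ≈⟨ cube ⟩
               p ^ 9                 ∎)))
             (*-congˡ (jtp (begin
               b ^ 3 * p ^ 6 * a ^ 3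
                 ≈⟨ solve 3 (λ a b p → b :^ 3 :* p :^ 6 :* a :^ 3 := (a :* b) :^ 3 :* p :^ 6) refl a b p ⟩
               (a * b) ^ 3 * p ^ 6   ≈⟨ cube ⟩
               p ^ 9                 ∎)))) ⟩
      _ ∎
      where
      n : ℕ
      -- The smallest cut-off that `jacobi-triple-product` admits; it admits `n * 3` as well.
      n = suc (N ℕ.+ N)
      cube : (a * b) ^ 3 * p ^ 6 ≈ p ^ 9
      cube = trans (*-congʳ (^-congˡ 3 ab≈p)) (sym (^-homo-* p 3 6))
      jtp : ∀ {u v} → u * v ≈ p ^ 9 → thetaSum n u v (p ^ 9) ≈ tripleProduct u v (p ^ 9)
      jtp uv≈p⁹ = jacobi-triple-product n uv≈p⁹ (Nil-* (p ^ 8) p^N≈0) ℕ.≤-refl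

    -- Y m u v p = (u v; p²)_m / ((u; p)_m (v; p)_m)
    Y : ℕ → Carrier → Carrier → Carrier → Carrier
    Y zero    u v p = 1#
    Y (suc m) u v p = Y m u v p * (geo N (u * p ^ m) + v * p ^ m * geo N (v * p ^ m))

    -- 1 - x y = (1 - y) + y (1 - x), hence (1 - x y) / ((1 - x) (1 - y)) = 1 / (1 - x) + y / (1 - y).
    1-xy : ∀ {x y} → Nil x → Nil y →
      1# + -1# * (x * y) ≈ (1# + -1# * x) * (1# + -1# * y) * (geo N x + y * geo N y)
    1-xy {x} {y} x^N≈0 y^N≈0 = sym (begin
      (1# + -1# * x) * (1# + -1# * y) * (geo N x + y * geo N y)
        ≈⟨ solve 5 (λ e x y a b →
             (con 1 :+ e :* x) :* (con 1 :+ e :* y) :* (a :+ y :* b)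
             := (con 1 :+ e :* x) :* a :* (con 1 :+ e :* y) :+ y :* (con 1 :+ e :* x) :* ((con 1 :+ e :* y) :* b))
             refl -1# x y _ _ ⟩
      (1# + -1# * x) * geo N x * (1# + -1# * y) + y * (1# + -1# * x) * ((1# + -1# * y) * geo N y)
        ≈⟨ +-cong (*-congʳ (Unit-1-x x^N≈0)) (*-congˡ (Unit-1-x y^N≈0)) ⟩
      1# * (1# + -1# * y) + y * (1# + -1# * x) * 1#
        ≈⟨ solve 3 (λ e x y →
             con 1 :* (con 1 :+ e :* y) :+ y :* (con 1 :+ e :* x) :* con 1
             := con 1 :+ e :* (x :* y) :+ (con 1 :+ e) :* y) refl -1# x y ⟩
      1# + -1# * (x * y) + (1# + -1#) * y   ≈⟨ cancel-1 _ y ⟩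
      1# + -1# * (x * y)                    ∎)

    -- Apply `1-xy` to each factor, with x = u p^i and y = v p^i.
    P-pair : ∀ {u v} m p → Nil u → Nil v →
      P m (-1# * (u * v)) (p ^ 2) ≈ P m (-1# * u) p * P m (-1# * v) p * Y m u v p
    P-pair         zero    p _     _     = sym (trans (*-identityʳ _) (*-identityˡ 1#))
    P-pair {u} {v} (suc m) p u^N≈0 v^N≈0 = begin
      P m (-1# * (u * v)) (p ^ 2) * (1# + -1# * (u * v) * (p ^ 2) ^ m)
        ≈⟨ *-cong (P-pair m p u^N≈0 v^N≈0) (+-congˡ (begin
             -1# * (u * v) * (p ^ 2) ^ m
               ≈⟨ *-congˡ (trans (^-*-assoc p 2 m (ℕ.*-comm 2 m)) (sym (^-assocʳ p m 2))) ⟩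
             -1# * (u * v) * (p ^ m) ^ 2
               ≈⟨ solve 4 (λ e u v y → e :* (u :* v) :* y :^ 2 := e :* (u :* y :* (v :* y))) refl -1# u v _ ⟩
             -1# * (u * p ^ m * (v * p ^ m)) ∎)) ⟩
      _ * _ * _ * (1# + -1# * (u * p ^ m * (v * p ^ m)))
        ≈⟨ *-congˡ (1-xy (Nil-* (p ^ m) u^N≈0) (Nil-* (p ^ m) v^N≈0)) ⟩
      _ * _ * _ * ((1# + -1# * (u * p ^ m)) * (1# + -1# * (v * p ^ m)) * _)
        ≈⟨ solve 8 (λ a b c e u v y g →
             a :* b :* c :* ((con 1 :+ e :* (u :* y)) :* (con 1 :+ e :* (v :* y)) :* g)
             := a :* (con 1 :+ e :* u :* y) :* (b :* (con 1 :+ e :* v :* y)) :* (c :* g))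
             refl _ _ _ -1# u v (p ^ m) _ ⟩
      _ ∎

    -- h x = (-x; x)_∞ and o x = (x; x²)_∞
    h o : Carrier → Carrier
    h x = P∞ x x
    o x = P∞ (-1# * x) (x ^ 2)

    -- Identities between infinite products

    P∞-halves : ∀ {p} u → Nil p → P∞ u p ≈ P∞ u (p ^ 2) * P∞ (u * p) (p ^ 2)
    P∞-halves {p} u p^N≈0 = trans (sym (P-stable u p^N≈0 (ℕ.m≤m*n N 2))) (P-halves N u p)

    -- Cutting off at `N * 3` instead of `N` gives the same product and leaves `N` factors in each
    -- class.
    P∞-thirds : ∀ {p} u → Nil p →
      P∞ u p ≈ P∞ u (p ^ 3) * P∞ (u * p) (p ^ 3) * P∞ (u * p ^ 2) (p ^ 3)
    P∞-thirds {p} u p^N≈0 = trans (sym (P-stable u p^N≈0 (ℕ.m≤m*n N 3))) (P-thirds N u p)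

    o-E : ∀ {x} → Nil x → o x * E∞ (x ^ 2) ≈ E∞ x
    o-E {x} x^N≈0 = sym (trans (P∞-halves (-1# * x) x^N≈0) (*-congˡ (P-cong N
      (solve 2 (λ e x → e :* x :* x := e :* x :^ 2) refl -1# x) refl)))

    h-E : ∀ x → h x * E∞ x ≈ E∞ (x ^ 2)
    h-E x = sym (P-square N x x)

    -- Euler's identity between partitions into distinct parts and into odd parts.
    o-h : ∀ {x} → Nil x → o x * h x ≈ 1#
    o-h {x} x^N≈0 = Unit-cancel (P-unit N x x^N≈0) _ _ (begin
      E∞ x * (o x * h x)      ≈⟨ solve 3 (λ E o h → E :* (o :* h) := o :* (h :* E)) refl _ _ _ ⟩
      o x * (h x * E∞ x)      ≈⟨ *-congˡ (h-E x) ⟩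
      o x * E∞ (x ^ 2)        ≈⟨ o-E x^N≈0 ⟩
      E∞ x                    ≈⟨ *-identityʳ _ ⟨
      E∞ x * 1#               ∎)

    P∞-1 : ∀ {p} → Nil p → P∞ 1# p ≈ (1# + 1#) * h p
    P∞-1 {p} p^N≈0 = begin
      -- One more factor is harmless, and keeps `N` of them when 1 + 1 is split off in front.
      P∞ 1# p                        ≈⟨ P-stable 1# p^N≈0 (ℕ.n≤1+n N) ⟨
      P (suc N) 1# p                 ≈⟨ P-head N 1# p ⟩
      (1# + 1#) * P∞ (1# * p) p      ≈⟨ *-congˡ (P-cong N (*-identityˡ p) refl) ⟩
      (1# + 1#) * h p                ∎

    -- W x = (-x; x³)_∞ (-x²; x³)_∞ and V x = (x; x³)_∞ (x²; x³)_∞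
    W V : Carrier → Carrier
    W x = P∞ x (x ^ 3) * P∞ (x ^ 2) (x ^ 3)
    V x = P∞ (-1# * x) (x ^ 3) * P∞ (-1# * x ^ 2) (x ^ 3)

    W-h : ∀ {x} → Nil x → W x * h (x ^ 3) ≈ h x
    W-h {x} x^N≈0 = sym (trans (P∞-thirds x x^N≈0) (*-congʳ (*-congˡ (P-cong N
      (*-congˡ (sym (*-identityʳ x))) refl))))

    V-E : ∀ {x} → Nil x → V x * E∞ (x ^ 3) ≈ E∞ x
    V-E {x} x^N≈0 = sym (trans (P∞-thirds (-1# * x) x^N≈0) (*-cong
      (*-congˡ (P-cong N (solve 2 (λ e x → e :* x :* x := e :* x :^ 2) refl -1# x) refl))
      (P-cong N (solve 2 (λ e x → e :* x :* x :^ 2 := e :* x :^ 3) refl -1# x) refl)))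

    -- Ramanujan's theta function f(-x, -x⁵), equal to (x; x⁶)_∞ (x⁵; x⁶)_∞ (x⁶; x⁶)_∞.
    Ω : Carrier → Carrier
    Ω x = tripleProduct (-1# * x ^ 5) (-1# * x) ((x ^ 3) ^ 2)

    -- Modulo 6, the odd exponents in `o x` are 1, 3 and 5. The class of 3 is `o (x ^ 3)`; it is
    -- inserted together with its inverse `h (x ^ 3)`.
    Ω-formula : ∀ {x} → Nil x → Ω x ≈ o x * E∞ ((x ^ 3) ^ 2) * h (x ^ 3)
    Ω-formula {x} x^N≈0 = begin
      A * B * E∞ ((x ^ 3) ^ 2)                                   ≈⟨ *-identityʳ _ ⟨
      A * B * E∞ ((x ^ 3) ^ 2) * 1#                              ≈⟨ *-congˡ (o-h (Nil-* (x ^ 2) x^N≈0)) ⟨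
      A * B * E∞ ((x ^ 3) ^ 2) * (o (x ^ 3) * h (x ^ 3))
        ≈⟨ solve 5 (λ A B E o h → A :* B :* E :* (o :* h) := B :* o :* A :* E :* h) refl A B _ _ _ ⟩
      B * o (x ^ 3) * A * E∞ ((x ^ 3) ^ 2) * h (x ^ 3)           ≈⟨ *-congʳ (*-congʳ (sym thirds)) ⟩
      o x * E∞ ((x ^ 3) ^ 2) * h (x ^ 3)                         ∎
      where
      A B : Carrier
      A = P∞ (-1# * x ^ 5) ((x ^ 3) ^ 2)
      B = P∞ (-1# * x) ((x ^ 3) ^ 2)
      x⁶ : (x ^ 2) ^ 3 ≈ (x ^ 3) ^ 2
      x⁶ = solve 1 (λ x → (x :^ 2) :^ 3 := (x :^ 3) :^ 2) refl x
      thirds : o x ≈ B * o (x ^ 3) * A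
      thirds = trans (P∞-thirds (-1# * x) (Nil-* (x ^ 1) x^N≈0)) (*-cong
        (*-cong (P-cong N refl x⁶)
                (P-cong N (solve 2 (λ e x → e :* x :* x :^ 2 := e :* x :^ 3) refl -1# x) x⁶))
        (P-cong N (solve 2 (λ e x → e :* x :* (x :^ 2) :^ 2 := e :* x :^ 5) refl -1# x) x⁶))

    -- The parts of f₁ f₂ / f₃² with exponents 0, 1, 2 mod 3 are X₀, -q X₁ and -2 q² X₂, evaluated at x = q³.
    g X₀ X₁ X₂ : Carrier → Carrier
    g x  = g₃ N x x
    X₀ x = g x * (Y N x (x ^ 2) (x ^ 3) * W x)
    X₁ x = g x * (g x * h (x ^ 3))
    X₂ x = g x * (g₃ N (x ^ 2) (x ^ 2) * h (x ^ 3) ^ 3)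

    -- The 3-dissection of f₁ f₂ and of its quotient by f₃²

    module _ {q : Carrier} (q^N≈0 : Nil q) where

      private
        Q : Carrier
        Q = q ^ 3

        Q^N≈0 : Nil Q
        Q^N≈0 = Nil-* (q ^ 2) q^N≈0

        Q³^N≈0 : Nil (Q ^ 3)
        Q³^N≈0 = Nil-* (Q ^ 2) Q^N≈0

      -- The triple product on the left is φ(-q).
      φ-thirds : o q * o q * E∞ (q ^ 2) ≈
        o (Q ^ 3) * o (Q ^ 3) * E∞ ((Q ^ 3) ^ 2) + -1# * q * (Ω Q + Ω Q)
      φ-thirds = begin
        tripleProduct (-1# * q) (-1# * q) (q ^ 2)
          -- Here a = b = -q and p = q², so the classes of 1 and -1 give the same product.
          ≈⟨ tripleProduct-thirds
               (trans (solve 2 (λ e q → e :* q :* (e :* q) := e :* e :* q :^ 2) refl -1# q)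
                      (trans (*-congʳ -1*-1≈1) (*-identityˡ _)))
               (Nil-* (q ^ 1) q^N≈0) ⟩
        _ + (-1# * q * tripleProduct _ _ _ + -1# * q * tripleProduct _ _ _)
          ≈⟨ +-cong (tripleProduct-cong uQ³ uQ³ q¹⁸)
               (+-cong (*-congˡ (tripleProduct-cong uQ⁵ uQ q¹⁸)) (*-congˡ (tripleProduct-cong uQ⁵ uQ q¹⁸))) ⟩
        _ + (-1# * q * Ω Q + -1# * q * Ω Q)   ≈⟨ +-congˡ (distribˡ _ _ _) ⟨
        _ ∎
        where
        q¹⁸ : (q ^ 2) ^ 9 ≈ (Q ^ 3) ^ 2
        q¹⁸ = solve 1 (λ q → (q :^ 2) :^ 9 := ((q :^ 3) :^ 3) :^ 2) refl q
        -- Reduces the cube of -1, which the solver leaves as a power of a variable, to a single -1.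
        drop : ∀ {x y} → x ≈ -1# * -1# * (-1# * y) → x ≈ -1# * y
        drop x≈ = trans x≈ (trans (*-congʳ -1*-1≈1) (*-identityˡ _))
        uQ³ : (-1# * q) ^ 3 * (q ^ 2) ^ 3 ≈ -1# * Q ^ 3
        uQ³ = drop (solve 2 (λ e q → (e :* q) :^ 3 :* (q :^ 2) :^ 3 := e :* e :* (e :* (q :^ 3) :^ 3)) refl -1# q)
        uQ⁵ : (-1# * q) ^ 3 * (q ^ 2) ^ 6 ≈ -1# * Q ^ 5
        uQ⁵ = drop (solve 2 (λ e q → (e :* q) :^ 3 :* (q :^ 2) :^ 6 := e :* e :* (e :* (q :^ 3) :^ 5)) refl -1# q)
        uQ : (-1# * q) ^ 3 ≈ -1# * Q
        uQ = drop (solve 2 (λ e q → (e :* q) :^ 3 := e :* e :* (e :* q :^ 3)) refl -1# q)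

      -- The triple product on the left is 2 ψ(q) = Σ_j q^(j(j-1)/2), where j runs over all integers.
      2ψ-thirds : (1# + 1#) * h q * h q * E∞ q ≈
        (1# + 1#) * (W Q * E∞ (Q ^ 3) + q * (h (Q ^ 3) * h (Q ^ 3) * E∞ (Q ^ 3)))
      2ψ-thirds = begin
        (1# + 1#) * h q * h q * E∞ q   ≈⟨ *-congʳ (*-congʳ (P∞-1 q^N≈0)) ⟨
        tripleProduct 1# q q           ≈⟨ tripleProduct-thirds (*-identityˡ q) q^N≈0 ⟩
        _ + (1# * tripleProduct _ _ _ + q * tripleProduct _ _ _)
          ≈⟨ +-cong
               (tripleProduct-cong
                 (solve 1 (λ q → con 1 :^ 3 :* q :^ 3 := q :^ 3) refl q)
                 (solve 1 (λ q → q :^ 3 :* q :^ 3 := (q :^ 3) :^ 2) refl q) q⁹)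
               (+-cong
                 (*-congˡ (tripleProduct-cong
                   (solve 1 (λ q → con 1 :^ 3 :* q :^ 6 := (q :^ 3) :^ 2) refl q) refl q⁹))
                 (*-congˡ (tripleProduct-cong
                   (solve 1 (λ q → q :^ 3 :* q :^ 6 := (q :^ 3) :^ 3) refl q)
                   (solve 0 (con 1 :^ 3 := con 1) refl) q⁹))) ⟩
        P∞ Q (Q ^ 3) * P∞ (Q ^ 2) (Q ^ 3) * e + (1# * (P∞ (Q ^ 2) (Q ^ 3) * P∞ Q (Q ^ 3) * e)
          + q * (h (Q ^ 3) * P∞ 1# (Q ^ 3) * e))
          -- The classes of 0 and 1 coincide. In the class of -1 one parameter is 1 again, so the
          -- factor 2 comes out of the whole right-hand side.
          ≈⟨ +-congˡ (+-congˡ (*-congˡ (*-congʳ (*-congˡ (P∞-1 Q³^N≈0))))) ⟩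
        _ + (_ + q * (h (Q ^ 3) * ((1# + 1#) * h (Q ^ 3)) * e))
          ≈⟨ solve 5 (λ a b e q h →
               a :* b :* e :+ (con 1 :* (b :* a :* e) :+ q :* (h :* ((con 1 :+ con 1) :* h) :* e))
               := (con 1 :+ con 1) :* (a :* b :* e :+ q :* (h :* h :* e))) refl _ _ e q _ ⟩
        _ ∎
        where
        e : Carrier
        e = E∞ (Q ^ 3)
        q⁹ : q ^ 9 ≈ Q ^ 3
        q⁹ = solve 1 (λ q → q :^ 9 := (q :^ 3) :^ 3) refl q

      -- Since `o q * h q` is 1, the product of φ(-q) and 2 ψ(q) is 2 f₁ f₂, and the two dissections
      -- are multiplied out. The factor 2 stays because R may have 2-torsion.
      2E₁E₂ : (1# + 1#) * (E∞ q * E∞ (q ^ 2)) ≈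
        (1# + 1#) * (E∞ (Q ^ 3) * E∞ ((Q ^ 3) ^ 2) *
          (o (Q ^ 3) * o (Q ^ 3) * W Q
            + -1# * (q * (1# + q * (o Q * h (Q ^ 3) ^ 3 + o Q * h (Q ^ 3) ^ 3)))))
      2E₁E₂ = begin
        (1# + 1#) * (E∞ q * E∞ (q ^ 2))
          ≈⟨ *-congˡ (*-cong (o-E q^N≈0) (h-E q)) ⟨
        (1# + 1#) * (o q * E∞ (q ^ 2) * (h q * E∞ q))
          ≈⟨ trans (*-congˡ (o-h q^N≈0)) (*-identityʳ _) ⟨
        (1# + 1#) * (o q * E∞ (q ^ 2) * (h q * E∞ q)) * (o q * h q)
          ≈⟨ solve 4 (λ o h E₁ E₂ →
               (con 1 :+ con 1) :* (o :* E₂ :* (h :* E₁)) :* (o :* h)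
               := o :* o :* E₂ :* ((con 1 :+ con 1) :* h :* h :* E₁)) refl _ _ _ _ ⟩
        o q * o q * E∞ (q ^ 2) * ((1# + 1#) * h q * h q * E∞ q)
          ≈⟨ *-cong (trans φ-thirds (+-congˡ (*-congˡ (+-cong (Ω-formula Q^N≈0) (Ω-formula Q^N≈0))))) 2ψ-thirds ⟩
        (o₉ * o₉ * E₁₈ + -1# * q * (o₃ * E₁₈ * h₉ + o₃ * E₁₈ * h₉))
          * ((1# + 1#) * (w * E₉ + q * (h₉ * h₉ * E₉)))
          ≈⟨ solve 8 (λ o₉ E₁₈ e q o₃ h₉ w E₉ →
               (o₉ :* o₉ :* E₁₈ :+ e :* q :* (o₃ :* E₁₈ :* h₉ :+ o₃ :* E₁₈ :* h₉))
                 :* ((con 1 :+ con 1) :* (w :* E₉ :+ q :* (h₉ :* h₉ :* E₉)))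
               := (con 1 :+ con 1) :* (E₉ :* E₁₈ :*
                    (o₉ :* o₉ :* w :+ q :* (o₉ :* h₉) :^ 2
                     :+ e :* q :* (o₃ :* (w :* h₉) :+ o₃ :* (w :* h₉))
                     :+ e :* q :* q :* (o₃ :* h₉ :^ 3 :+ o₃ :* h₉ :^ 3))))
               refl o₉ E₁₈ -1# q o₃ h₉ w E₉ ⟩
        (1# + 1#) * (E₉ * E₁₈ *
          (o₉ * o₉ * w + q * (o₉ * h₉) ^ 2 + -1# * q * (o₃ * (w * h₉) + o₃ * (w * h₉))
            + -1# * q * q * (o₃ * h₉ ^ 3 + o₃ * h₉ ^ 3)))
          -- Both products become 1, so the part of exponent 1 modulo 3 is q - 2 q = -q.
          ≈⟨ *-congˡ (*-congˡ (+-congʳ (+-cong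
               (+-congˡ (*-congˡ (^-congˡ 2 (o-h Q³^N≈0)))) (*-congˡ (+-cong o₃wh₉ o₃wh₉))))) ⟩
        (1# + 1#) * (E₉ * E₁₈ *
          (o₉ * o₉ * w + q * 1# ^ 2 + -1# * q * (1# + 1#) + -1# * q * q * (o₃ * h₉ ^ 3 + o₃ * h₉ ^ 3)))
          ≈⟨ *-congˡ (*-congˡ (solve 4 (λ a q e x →
               a :+ q :* con 1 :^ 2 :+ e :* q :* (con 1 :+ con 1) :+ e :* q :* q :* x
               := a :+ e :* (q :* (con 1 :+ q :* x)) :+ (con 1 :+ e) :* q) refl _ q -1# _)) ⟩
        (1# + 1#) * (E₉ * E₁₈ *
          (o₉ * o₉ * w + -1# * (q * (1# + q * (o₃ * h₉ ^ 3 + o₃ * h₉ ^ 3))) + (1# + -1#) * q))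
          ≈⟨ *-congˡ (*-congˡ (cancel-1 _ q)) ⟩
        _ ∎
        where
        o₃ o₉ h₉ w E₉ E₁₈ : Carrier
        o₃ = o Q
        o₉ = o (Q ^ 3)
        h₉ = h (Q ^ 3)
        w = W Q
        E₉ = E∞ (Q ^ 3)
        E₁₈ = E∞ ((Q ^ 3) ^ 2)
        o₃wh₉ : o₃ * (w * h₉) ≈ 1#
        o₃wh₉ = trans (*-congˡ (W-h Q^N≈0)) (o-h Q^N≈0)

      -- Multiplied by the unit E₃², the left side becomes f₁ f₂, and `eq₀`, `eq₁`, `eq₂` match its
      -- three parts. The first premise frees `2E₁E₂` from its factor 2.
      quotient-thirds : (∀ x y → (1# + 1#) * x ≈ (1# + 1#) * y → x ≈ y) →
        ∀ {a f₁ f₂ f₃ q³} → q³ ≡ q ^ 3 →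
        f₁ ≈ E∞ (q ^ 1) → f₂ ≈ E∞ (q ^ 2) → f₃ ≈ E∞ (q ^ 3) → a * (f₃ * f₃) ≈ f₁ * f₂ →
        a ≈ X₀ q³ + -1# * (q * (X₁ q³ + q * (X₂ q³ + X₂ q³)))
      quotient-thirds 2-cancel {a} {f₁} {f₂} {f₃} ≡.refl f₁≈ f₂≈ f₃≈ af₃²≈f₁f₂ =
        Unit-cancel (Unit-* (P-unit N Q Q^N≈0) (P-unit N Q Q^N≈0)) _ _ (begin
        E₃ * E₃ * a                      ≈⟨ *-comm _ a ⟩
        a * (E₃ * E₃)                    ≈⟨ *-congˡ (*-cong f₃≈ f₃≈) ⟨
        a * (f₃ * f₃)                    ≈⟨ af₃²≈f₁f₂ ⟩
        f₁ * f₂                          ≈⟨ *-cong (trans f₁≈ (P-cong N (*-congˡ (*-identityʳ q)) (*-identityʳ q))) f₂≈ ⟩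
        E∞ q * E∞ (q ^ 2)                ≈⟨ 2-cancel _ _ 2E₁E₂ ⟩
        E₉ * E₁₈ * (o₉ * o₉ * w + -1# * (q * (1# + q * (x + x))))
          ≈⟨ solve 5 (λ F b e q x →
               F :* (b :+ e :* (q :* (con 1 :+ q :* (x :+ x))))
               := F :* b :+ e :* (q :* (F :+ q :* (F :* x :+ F :* x)))) refl (E₉ * E₁₈) _ -1# q x ⟩
        E₉ * E₁₈ * (o₉ * o₉ * w) + -1# * (q * (E₉ * E₁₈ + q * (E₉ * E₁₈ * x + E₉ * E₁₈ * x)))
          ≈⟨ +-cong eq₀ (*-congˡ (*-congˡ (+-cong eq₁ (*-congˡ (+-cong eq₂ eq₂))))) ⟩
        E₃ * E₃ * X₀ Q + -1# * (q * (E₃ * E₃ * X₁ Q + q * (E₃ * E₃ * X₂ Q + E₃ * E₃ * X₂ Q)))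
          ≈⟨ solve 6 (λ F e q x₀ x₁ x₂ →
               F :* x₀ :+ e :* (q :* (F :* x₁ :+ q :* (F :* x₂ :+ F :* x₂)))
               := F :* (x₀ :+ e :* (q :* (x₁ :+ q :* (x₂ :+ x₂))))) refl (E₃ * E₃) -1# q (X₀ Q) (X₁ Q) (X₂ Q) ⟩
        E₃ * E₃ * (X₀ Q + -1# * (q * (X₁ Q + q * (X₂ Q + X₂ Q)))) ∎)
        where
        o₃ o₉ h₉ w E₃ E₆ E₉ E₁₈ x g′ y v : Carrier
        o₃ = o Q
        o₉ = o (Q ^ 3)
        h₉ = h (Q ^ 3)
        w = W Q
        E₃ = E∞ Q
        E₆ = E∞ (Q ^ 2)
        E₉ = E∞ (Q ^ 3)
        E₁₈ = E∞ ((Q ^ 3) ^ 2)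
        x = o₃ * h₉ ^ 3
        g′ = g₃ N (Q ^ 2) (Q ^ 2)
        y = Y N Q (Q ^ 2) (Q ^ 3)
        v = V Q
        E₉≈ : E₉ ≈ E₃ * g Q
        E₉≈ = P-cube N Q Q
        E₁₈≈ : E₁₈ ≈ E₆ * g′
        E₁₈≈ = trans (P-cong N (*-congˡ Q⁶) Q⁶) (P-cube N (Q ^ 2) (Q ^ 2))
          where
          Q⁶ : (Q ^ 3) ^ 2 ≈ (Q ^ 2) ^ 3
          Q⁶ = solve 1 (λ Q → (Q :^ 3) :^ 2 := (Q :^ 2) :^ 3) refl Q
        eq₀ : E₉ * E₁₈ * (o₉ * o₉ * w) ≈ E₃ * E₃ * X₀ Q
        eq₀ = begin
          E₉ * E₁₈ * (o₉ * o₉ * w)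
            ≈⟨ solve 4 (λ a b o w → a :* b :* (o :* o :* w) := (o :* b) :* (o :* (a :* w))) refl E₉ E₁₈ o₉ w ⟩
          o₉ * E₁₈ * (o₉ * (E₉ * w))
            -- One `o₉` turns E₁₈ into E₉. The other is (Q³; Q⁶)_∞ with Q³ = Q Q², so `P-pair`
            -- replaces it by `V Q` times the subtraction-free `y`.
            ≈⟨ *-cong (trans (o-E Q³^N≈0) E₉≈)
                 (*-congʳ (P-pair N (Q ^ 3) Q^N≈0 (Nil-* (Q ^ 1) Q^N≈0))) ⟩
          E₃ * g Q * (v * y * (E₉ * w))
            ≈⟨ solve 6 (λ E g v y a w → E :* g :* (v :* y :* (a :* w)) := E :* (v :* a) :* (g :* (y :* w)))
                 refl E₃ (g Q) v y E₉ w ⟩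
          E₃ * (v * E₉) * X₀ Q     ≈⟨ *-congʳ (*-congˡ (V-E Q^N≈0)) ⟩
          E₃ * E₃ * X₀ Q           ∎
        eq₁ : E₉ * E₁₈ ≈ E₃ * E₃ * X₁ Q
        eq₁ = begin
          E₉ * E₁₈               ≈⟨ *-congˡ (h-E (Q ^ 3)) ⟨
          E₉ * (h₉ * E₉)         ≈⟨ *-cong E₉≈ (*-congˡ E₉≈) ⟩
          E₃ * g Q * (h₉ * (E₃ * g Q))
            ≈⟨ solve 3 (λ E g h → E :* g :* (h :* (E :* g)) := E :* E :* (g :* (g :* h))) refl E₃ (g Q) h₉ ⟩
          E₃ * E₃ * X₁ Q           ∎
        eq₂ : E₉ * E₁₈ * x ≈ E₃ * E₃ * X₂ Q
        eq₂ = begin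
          E₉ * E₁₈ * (o₃ * h₉ ^ 3)                ≈⟨ *-congʳ (*-cong E₉≈ E₁₈≈) ⟩
          E₃ * g Q * (E₆ * g′) * (o₃ * h₉ ^ 3)
            ≈⟨ solve 6 (λ E g E₆ g′ o t → E :* g :* (E₆ :* g′) :* (o :* t) := E :* (o :* E₆) :* (g :* (g′ :* t)))
                 refl E₃ (g Q) E₆ g′ o₃ (h₉ ^ 3) ⟩
          E₃ * (o₃ * E₆) * X₂ Q                     ≈⟨ *-congʳ (*-congˡ (o-E Q^N≈0)) ⟩
          E₃ * E₃ * X₂ Q                            ∎

-- Power series over ℤ modulo q^N

module SeriesRing where
  open import Data.Bool.Base using (if_then_else_)
  open import Data.Integer.Base using (ℤ; 0ℤ; 1ℤ; _+_; _*_; -_)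
  import Data.Integer.Properties as ℤ
  open import Data.Integer.Tactic.RingSolver using (solve-∀)
  open import Function.Base using (_∘_; const)
  open ≡ using (refl; sym; trans; cong; cong₂; _≗_; module ≡-Reasoning)
  open ≡-Reasoning

  infixl 6 _⊕_

  _⊕_ : Series → Series → Series
  (A ⊕ B) n = A n + B n

  ⊝_ : Series → Series
  (⊝ A) n = - A n

  -- Coefficient n of a product involves coefficients up to n only, so equality below q^N is
  -- compatible with multiplication.
  ⊛-cong-≤ : ∀ {A A′ B B′} n → (∀ i → i ℕ.≤ n → A i ≡ A′ i) → (∀ i → i ℕ.≤ n → B i ≡ B′ i) →
    (A ⊛ B) n ≡ (A′ ⊛ B′) n
  ⊛-cong-≤ zero    A≡ B≡ = cong (_+ 0ℤ) (cong₂ _*_ (A≡ 0 ℕ.z≤n) (B≡ 0 ℕ.z≤n))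
  ⊛-cong-≤ (suc n) A≡ B≡ = cong₂ _+_ (cong₂ _*_ (A≡ 0 ℕ.z≤n) (B≡ (suc n) ℕ.≤-refl))
    (⊛-cong-≤ n (λ i i≤n → A≡ (suc i) (ℕ.s≤s i≤n)) (λ i i≤n → B≡ i (ℕ.m≤n⇒m≤1+n i≤n)))

  ⊛-zeroˡ : ∀ A → const 0ℤ ⊛ A ≗ const 0ℤ
  ⊛-zeroˡ A zero    = refl
  ⊛-zeroˡ A (suc n) = trans (ℤ.+-identityˡ _) (⊛-zeroˡ A n)

  ⊛-identityˡ : ∀ A → q^ 0 ⊛ A ≗ A
  ⊛-identityˡ A zero    = trans (ℤ.+-identityʳ _) (ℤ.*-identityˡ _)
  ⊛-identityˡ A (suc n) =
    trans (cong₂ _+_ (ℤ.*-identityˡ (A (suc n))) (⊛-zeroˡ A n)) (ℤ.+-identityʳ _)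

  ⊛-distribʳ : ∀ C A B → (A ⊕ B) ⊛ C ≗ (A ⊛ C) ⊕ (B ⊛ C)
  ⊛-distribʳ C A B zero    = lemma (A 0) (B 0) (C 0)
    where
    lemma : ∀ a b c → (a + b) * c + 0ℤ ≡ (a * c + 0ℤ) + (b * c + 0ℤ)
    lemma = solve-∀
  ⊛-distribʳ C A B (suc n) = begin
    (A 0 + B 0) * C (suc n) + ((A ∘ suc ⊕ B ∘ suc) ⊛ C) n
      ≡⟨ cong ((A 0 + B 0) * C (suc n) +_) (⊛-distribʳ C (A ∘ suc) (B ∘ suc) n) ⟩
    (A 0 + B 0) * C (suc n) + ((A ∘ suc ⊛ C) n + (B ∘ suc ⊛ C) n)
      ≡⟨ lemma (A 0) (B 0) (C (suc n)) _ _ ⟩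
    (A ⊛ C) (suc n) + (B ⊛ C) (suc n) ∎
    where
    lemma : ∀ a b c x y → (a + b) * c + (x + y) ≡ (a * c + x) + (b * c + y)
    lemma = solve-∀

  -- Convolution computes from its first summand. Commutativity reverses the order and has to take
  -- off the last one.
  ⊛-last : ∀ A B n → (A ⊛ B) (suc n) ≡ (A ⊛ B ∘ suc) n + A (suc n) * B 0
  ⊛-last A B zero    = lemma (A 0) (A 1) (B 0) (B 1)
    where
    lemma : ∀ a a′ b b′ → a * b′ + (a′ * b + 0ℤ) ≡ a * b′ + 0ℤ + a′ * b
    lemma = solve-∀
  ⊛-last A B (suc n) =
    trans (cong (A 0 * B (suc (suc n)) +_) (⊛-last (A ∘ suc) B n)) (sym (ℤ.+-assoc (A 0 * B (suc (suc n))) _ _))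

  ⊛-comm : ∀ A B → A ⊛ B ≗ B ⊛ A
  ⊛-comm A B zero    = cong (_+ 0ℤ) (ℤ.*-comm (A 0) (B 0))
  ⊛-comm A B (suc n) = begin
    A 0 * B (suc n) + (A ∘ suc ⊛ B) n   ≡⟨ cong₂ _+_ (ℤ.*-comm (A 0) (B (suc n))) (⊛-comm (A ∘ suc) B n) ⟩
    B (suc n) * A 0 + (B ⊛ A ∘ suc) n   ≡⟨ ℤ.+-comm (B (suc n) * A 0) _ ⟩
    (B ⊛ A ∘ suc) n + B (suc n) * A 0   ≡⟨ ⊛-last B A n ⟨
    (B ⊛ A) (suc n)                     ∎

  ⊛-scaleˡ : ∀ c A B n → ((λ k → c * A k) ⊛ B) n ≡ c * (A ⊛ B) n
  ⊛-scaleˡ c A B zero    = lemma c (A 0) (B 0)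
    where
    lemma : ∀ c a b → c * a * b + 0ℤ ≡ c * (a * b + 0ℤ)
    lemma = solve-∀
  ⊛-scaleˡ c A B (suc n) =
    trans (cong (c * A 0 * B (suc n) +_) (⊛-scaleˡ c (A ∘ suc) B n)) (lemma c (A 0) (B (suc n)) _)
    where
    lemma : ∀ c a b x → c * a * b + c * x ≡ c * (a * b + x)
    lemma = solve-∀

  -- The tail of A ⊛ B is A₀ times the tail of B plus the tail of A times B, which gives an
  -- induction on the coefficient.
  ⊛-assoc : ∀ A B C → (A ⊛ B) ⊛ C ≗ A ⊛ (B ⊛ C)
  ⊛-assoc A B C zero    = lemma (A 0) (B 0) (C 0)
    where
    lemma : ∀ a b c → (a * b + 0ℤ) * c + 0ℤ ≡ a * (b * c + 0ℤ) + 0ℤ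
    lemma = solve-∀
  ⊛-assoc A B C (suc n) = begin
    (A 0 * B 0 + 0ℤ) * C (suc n) + (((λ k → A 0 * B (suc k)) ⊕ (A ∘ suc ⊛ B)) ⊛ C) n
      ≡⟨ cong ((A 0 * B 0 + 0ℤ) * C (suc n) +_) (⊛-distribʳ C (λ k → A 0 * B (suc k)) (A ∘ suc ⊛ B) n) ⟩
    (A 0 * B 0 + 0ℤ) * C (suc n) + (((λ k → A 0 * B (suc k)) ⊛ C) n + ((A ∘ suc ⊛ B) ⊛ C) n)
      ≡⟨ cong ((A 0 * B 0 + 0ℤ) * C (suc n) +_) (cong₂ _+_ (⊛-scaleˡ (A 0) (B ∘ suc) C n) (⊛-assoc (A ∘ suc) B C n)) ⟩
    (A 0 * B 0 + 0ℤ) * C (suc n) + (A 0 * (B ∘ suc ⊛ C) n + (A ∘ suc ⊛ (B ⊛ C)) n)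
      ≡⟨ lemma (A 0) (B 0) (C (suc n)) _ _ ⟩
    A 0 * (B ⊛ C) (suc n) + (A ∘ suc ⊛ (B ⊛ C)) n ∎
    where
    lemma : ∀ a b c x y → (a * b + 0ℤ) * c + (a * x + y) ≡ a * (b * c + x) + y
    lemma = solve-∀

  -- ℤ[[q]] / (q^N)
  truncatedRing : ℕ → CommutativeRing _ _
  truncatedRing N = record
    { Carrier = Series
    ; _≈_     = λ A B → ∀ n → n ℕ.< N → A n ≡ B n
    ; _+_     = _⊕_
    ; _*_     = _⊛_
    ; -_      = ⊝_
    ; 0#      = const 0ℤ
    ; 1#      = q^ 0
    ; isCommutativeRing = record
      { isRing = record
        { +-isAbelianGroup = record
          { isGroup = record
            { isMonoid = record
              { isSemigroup = record
                { isMagma = record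
                  { isEquivalence = record
                    { refl  = λ _ _ → refl
                    ; sym   = λ A≈B n n<N → sym (A≈B n n<N)
                    ; trans = λ A≈B B≈C n n<N → trans (A≈B n n<N) (B≈C n n<N)
                    }
                  ; ∙-cong = λ A≈B C≈D n n<N → cong₂ _+_ (A≈B n n<N) (C≈D n n<N)
                  }
                ; assoc = λ A B C n _ → ℤ.+-assoc (A n) (B n) (C n)
                }
              ; identity = (λ A n _ → ℤ.+-identityˡ (A n)) , (λ A n _ → ℤ.+-identityʳ (A n))
              }
            ; inverse = (λ A n _ → ℤ.+-inverseˡ (A n)) , (λ A n _ → ℤ.+-inverseʳ (A n))
            ; ⁻¹-cong = λ A≈B n n<N → cong -_ (A≈B n n<N)
            }
          ; comm = λ A B n _ → ℤ.+-comm (A n) (B n)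
          }
        ; *-cong = λ A≈B C≈D n n<N → ⊛-cong-≤ n
            (λ i i≤n → A≈B i (ℕ.≤-<-trans i≤n n<N)) (λ i i≤n → C≈D i (ℕ.≤-<-trans i≤n n<N))
        ; *-assoc    = λ A B C n _ → ⊛-assoc A B C n
        ; *-identity = (λ A n _ → ⊛-identityˡ A n) , (λ A n _ → trans (⊛-comm A (q^ 0) n) (⊛-identityˡ A n))
        ; distrib    = (λ C A B n _ → trans (⊛-comm C (A ⊕ B) n)
                          (trans (⊛-distribʳ C A B n) (cong₂ _+_ (⊛-comm A C n) (⊛-comm B C n))))
                     , (λ C A B n _ → ⊛-distribʳ C A B n)
        }
      ; *-comm = λ A B n _ → ⊛-comm A B n
      }
    }

  q⊛-suc : ∀ A n → (q^ 1 ⊛ A) (suc n) ≡ A n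
  q⊛-suc A n = trans (ℤ.+-identityˡ _) (⊛-identityˡ A n)

  q^-≢ : ∀ {m n} → n ≡.≢ m → (q^ m) n ≡ 0ℤ
  q^-≢ {m} {n} n≢m = cong (if_then 1ℤ else 0ℤ) (dec-false (n ℕ.≟ m) n≢m)

  q^-≡ : ∀ m → (q^ m) m ≡ 1ℤ
  q^-≡ m = cong (if_then 1ℤ else 0ℤ) (dec-true (m ℕ.≟ m) refl)

-- Nonnegative and positive coefficients

module Positivity where
  open import Data.Integer.Base as ℤ using (ℤ; 0ℤ; 1ℤ; _+_; _*_; _≤_; _<_)
  import Data.Integer.Properties as ℤ
  open import Function.Base using (_∘_)
  open ≡ using (refl; sym; trans; cong; cong₂; subst)
  open SeriesRing

  Nonneg : Series → Set
  Nonneg A = ∀ n → 0ℤ ≤ A n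

  *-nonneg : ∀ {x y} → 0ℤ ≤ x → 0ℤ ≤ y → 0ℤ ≤ x * y
  *-nonneg {x} {y} 0≤x 0≤y =
    subst (_≤ x * y) (ℤ.*-zeroʳ x) (ℤ.*-monoˡ-≤-nonNeg x {{ℤ.nonNegative 0≤x}} 0≤y)

  *-pos : ∀ {x y} → 0ℤ < x → 0ℤ < y → 0ℤ < x * y
  *-pos {x} {y} 0<x 0<y =
    subst (_< x * y) (ℤ.*-zeroʳ x) (ℤ.*-monoˡ-<-pos x {{ℤ.positive 0<x}} 0<y)

  ⊛-nonneg : ∀ {A B} → Nonneg A → Nonneg B → Nonneg (A ⊛ B)
  ⊛-nonneg 0≤A 0≤B zero    = ℤ.+-mono-≤ (*-nonneg (0≤A 0) (0≤B 0)) ℤ.≤-refl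
  ⊛-nonneg 0≤A 0≤B (suc n) = ℤ.+-mono-≤ (*-nonneg (0≤A 0) (0≤B (suc n))) (⊛-nonneg (0≤A ∘ suc) 0≤B n)

  ⊛-pos : ∀ {A B} n → Nonneg A → Nonneg B → 0ℤ < A 0 → 0ℤ < B n → 0ℤ < (A ⊛ B) n
  ⊛-pos zero    _   _   0<A₀ 0<Bₙ = ℤ.+-mono-<-≤ (*-pos 0<A₀ 0<Bₙ) ℤ.≤-refl
  ⊛-pos (suc n) 0≤A 0≤B 0<A₀ 0<Bₙ = ℤ.+-mono-<-≤ (*-pos 0<A₀ 0<Bₙ) (⊛-nonneg (0≤A ∘ suc) 0≤B n)

  -- Nonnegative series in q³. Because the three parts of the quotient are of this kind, each
  -- residue class modulo 3 receives its sign from one part alone.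
  record Cubic (A : Series) : Set where
    field
      nonneg : Nonneg A
      [1+3k] : ∀ k → A (1 ℕ.+ k ℕ.* 3) ≡ 0ℤ
      [2+3k] : ∀ k → A (2 ℕ.+ k ℕ.* 3) ≡ 0ℤ

  open Cubic

  ⊕-cubic : ∀ {A B} → Cubic A → Cubic B → Cubic (A ⊕ B)
  ⊕-cubic a b = record
    { nonneg = λ n → ℤ.+-mono-≤ (nonneg a n) (nonneg b n)
    ; [1+3k] = λ k → cong₂ _+_ ([1+3k] a k) ([1+3k] b k)
    ; [2+3k] = λ k → cong₂ _+_ ([2+3k] a k) ([2+3k] b k)
    }

  ⊛-cubic : ∀ {A B} → Cubic A → Cubic B → Cubic (A ⊛ B)
  ⊛-cubic a b = record
    { nonneg = ⊛-nonneg (nonneg a) (nonneg b)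
    ; [1+3k] = at-1 a b
    ; [2+3k] = at-2 a b
    }
    where
    sum₂ : ∀ {x y} → x ≡ 0ℤ → y ≡ 0ℤ → x + y ≡ 0ℤ
    sum₂ = cong₂ _+_
    left : ∀ {x} y → x ≡ 0ℤ → x * y ≡ 0ℤ
    left y refl = ℤ.*-zeroˡ y
    right : ∀ x {y} → y ≡ 0ℤ → x * y ≡ 0ℤ
    right x refl = ℤ.*-zeroʳ x
    -- Three steps of the convolution replace A by this shift and lower the index by 3. Each of the
    -- summands passed has a factor 0.
    drop₃ : ∀ {A} → Cubic A → Cubic (λ n → A (3 ℕ.+ n))
    drop₃ a = record
      { nonneg = λ n → nonneg a (3 ℕ.+ n)
      ; [1+3k] = λ k → [1+3k] a (suc k)
      ; [2+3k] = λ k → [2+3k] a (suc k)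
      }
    at-1 : ∀ {A B} → Cubic A → Cubic B → ∀ k → (A ⊛ B) (1 ℕ.+ k ℕ.* 3) ≡ 0ℤ
    at-1 {A} {B} a b zero    = sum₂ (right (A 0) ([1+3k] b 0)) (sum₂ (left (B 0) ([1+3k] a 0)) refl)
    at-1 {A} {B} a b (suc k) = sum₂ (right (A 0) ([1+3k] b (suc k)))
      (sum₂ (left (B (3 ℕ.+ k ℕ.* 3)) ([1+3k] a 0))
        (sum₂ (left (B (2 ℕ.+ k ℕ.* 3)) ([2+3k] a 0)) (at-1 (drop₃ a) b k)))
    at-2 : ∀ {A B} → Cubic A → Cubic B → ∀ k → (A ⊛ B) (2 ℕ.+ k ℕ.* 3) ≡ 0ℤ
    at-2 {A} {B} a b zero    = sum₂ (right (A 0) ([2+3k] b 0))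
      (sum₂ (left (B 1) ([1+3k] a 0)) (sum₂ (left (B 0) ([2+3k] a 0)) refl))
    at-2 {A} {B} a b (suc k) = sum₂ (right (A 0) ([2+3k] b (suc k)))
      (sum₂ (left (B (4 ℕ.+ k ℕ.* 3)) ([1+3k] a 0))
        (sum₂ (left (B (3 ℕ.+ k ℕ.* 3)) ([2+3k] a 0)) (at-2 (drop₃ a) b k)))

  1-cubic : Cubic (q^ 0)
  1-cubic = record
    { nonneg = λ { zero → ℤ.+≤+ ℕ.z≤n ; (suc _) → ℤ.≤-refl } ; [1+3k] = λ _ → refl ; [2+3k] = λ _ → refl }

  Cubic⁺ : Series → Set
  Cubic⁺ A = Cubic A × 0ℤ < A 0

  1-cubic⁺ : Cubic⁺ (q^ 0)
  1-cubic⁺ = 1-cubic , ℤ.+<+ (ℕ.s≤s ℕ.z≤n)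

  ⊛-cubic⁺ : ∀ {A B} → Cubic⁺ A → Cubic⁺ B → Cubic⁺ (A ⊛ B)
  ⊛-cubic⁺ (a , 0<A₀) (b , 0<B₀) = ⊛-cubic a b , ⊛-pos 0 (nonneg a) (nonneg b) 0<A₀ 0<B₀

  ⊕-cubic⁺ : ∀ {A B} → Cubic⁺ A → Cubic B → Cubic⁺ (A ⊕ B)
  ⊕-cubic⁺ (a , 0<A₀) b = ⊕-cubic a b , ℤ.+-mono-<-≤ 0<A₀ (nonneg b 0)

  -- The summand Aₙ B₀ is positive and the others are nonnegative.
  ⊛-posʳ : ∀ A B n → Cubic⁺ A → Cubic⁺ B → 0ℤ < A n → 0ℤ < (A ⊛ B) n
  ⊛-posʳ A B n (a , _) (b , 0<B₀) 0<Aₙ =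
    subst (0ℤ <_) (⊛-comm B A n) (⊛-pos {B} {A} n (nonneg b) (nonneg a) 0<B₀ 0<Aₙ)

  -- With A = X₁ and B = X₂ this is q X₁ + 2 q² X₂, the series subtracted from X₀, nested as in
  -- `quotient-thirds`.
  negativePart : Series → Series → Series
  negativePart A B = q^ 1 ⊛ (A ⊕ q^ 1 ⊛ (B ⊕ B))

  module _ {A B : Series} (a : Cubic A) (b : Cubic B) where

    private
      shifted : ∀ n → negativePart A B (suc n) ≡ A n + (q^ 1 ⊛ (B ⊕ B)) n
      shifted = q⊛-suc (A ⊕ q^ 1 ⊛ (B ⊕ B))

      shifted₂ : ∀ n → negativePart A B (2 ℕ.+ n) ≡ A (suc n) + (B n + B n)
      shifted₂ n = trans (shifted (suc n)) (cong (A (suc n) +_) (q⊛-suc (B ⊕ B) n))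

      qB-nonneg : Nonneg (q^ 1 ⊛ (B ⊕ B))
      qB-nonneg zero    = ℤ.≤-refl
      qB-nonneg (suc n) = subst (0ℤ ≤_) (sym (q⊛-suc (B ⊕ B) n)) (ℤ.+-mono-≤ (nonneg b n) (nonneg b n))

    -- The shifts move the exponents of A and B to the classes of 1 and 2 modulo 3.
    negativePart-3k : ∀ k → negativePart A B (k ℕ.* 3) ≡ 0ℤ
    negativePart-3k zero    = refl
    negativePart-3k (suc k) = trans (shifted₂ (1 ℕ.+ k ℕ.* 3))
      (cong₂ _+_ ([2+3k] a k) (cong₂ _+_ ([1+3k] b k) ([1+3k] b k)))

    negativePart-1+3k : ∀ k → 0ℤ < A (k ℕ.* 3) → 0ℤ < negativePart A B (1 ℕ.+ k ℕ.* 3)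
    negativePart-1+3k k 0<A = subst (0ℤ <_) (sym (shifted (k ℕ.* 3)))
      (ℤ.+-mono-<-≤ 0<A (qB-nonneg (k ℕ.* 3)))

    negativePart-2+3k : ∀ k → 0ℤ < B (k ℕ.* 3) → 0ℤ < negativePart A B (2 ℕ.+ k ℕ.* 3)
    negativePart-2+3k k 0<B = subst (0ℤ <_) (sym (shifted₂ (k ℕ.* 3)))
      (ℤ.+-mono-≤-< (nonneg a (1 ℕ.+ k ℕ.* 3)) (ℤ.+-mono-< 0<B 0<B))

  pos-< : ∀ {x y} → y ≡ 0ℤ → 0ℤ < x → 0ℤ < x ℤ.- y
  pos-< {x} refl 0<x = subst (0ℤ <_) (sym (ℤ.+-identityʳ x)) 0<x

  neg-< : ∀ {x y} → x ≡ 0ℤ → 0ℤ < y → x ℤ.- y < 0ℤ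
  neg-< {y = y} refl 0<y = subst (_< 0ℤ) (sym (ℤ.+-identityˡ (ℤ.- y))) (ℤ.neg-mono-< 0<y)

  -- Positivity of the factors of X₀, X₁ and X₂

  module Truncated (N : ℕ) (0<N : 0 ℕ.< N) where
    open QProducts (truncatedRing N)
    open Nilpotent N
    open CommutativeRing (truncatedRing N) using (commutativeSemiring; _≈_; *-cong; ring)
    open import Algebra.Properties.CommutativeSemiring.Exp commutativeSemiring
    open import Algebra.Properties.Ring ring using (-1*x≈-x)

    ^-cubic : ∀ {A} n → Cubic A → Cubic (A ^ n)
    ^-cubic zero    a = 1-cubic
    ^-cubic (suc n) a = ⊛-cubic a (^-cubic n a)

    P-cubic⁺ : ∀ {u p} m → Cubic u → Cubic p → Cubic⁺ (P m u p)
    P-cubic⁺ zero    u p = 1-cubic⁺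
    P-cubic⁺ (suc m) u p = ⊛-cubic⁺ (P-cubic⁺ m u p) (⊕-cubic⁺ 1-cubic⁺ (⊛-cubic u (^-cubic m p)))

    g₃-cubic⁺ : ∀ {u p} m → Cubic u → Cubic p → Cubic⁺ (g₃ m u p)
    g₃-cubic⁺ zero    u p = 1-cubic⁺
    g₃-cubic⁺ (suc m) u p = ⊛-cubic⁺ (g₃-cubic⁺ m u p) (⊕-cubic⁺ 1-cubic⁺ (⊕-cubic z (^-cubic 2 z)))
      where z = ⊛-cubic u (^-cubic m p)

    geo-cubic : ∀ {x} m → Cubic x → Cubic (geo m x)
    geo-cubic zero    x = record { nonneg = λ _ → ℤ.≤-refl ; [1+3k] = λ _ → refl ; [2+3k] = λ _ → refl }
    geo-cubic (suc m) x = ⊕-cubic 1-cubic (⊛-cubic x (geo-cubic m x))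

    -- An empty geometric sum is 0, so a positive constant term requires 0 < m; this is the source
    -- of the parameter `0<N`.
    geo-cubic⁺ : ∀ {x m} → 0 ℕ.< m → Cubic x → Cubic⁺ (geo m x)
    geo-cubic⁺ {m = suc m} _ x = ⊕-cubic⁺ 1-cubic⁺ (⊛-cubic x (geo-cubic m x))

    ^-q^ : ∀ m → (q^ 1) ^ m ≈ q^ m
    ^-q^ zero    n       _ = refl
    ^-q^ (suc m) zero    _ = refl
    ^-q^ (suc m) (suc n) n<N = trans (q⊛-suc ((q^ 1) ^ m) n) (^-q^ m n (ℕ.<-trans (ℕ.n<1+n n) n<N))

    q-nil : Nil (q^ 1)
    q-nil n n<N = trans (^-q^ N n n<N) (q^-≢ (ℕ.<⇒≢ n<N))

    -- Doubling acts on each coefficient, and ℤ has no 2-torsion.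
    2-cancel : ∀ A B → (q^ 0 ⊕ q^ 0) ⊛ A ≈ (q^ 0 ⊕ q^ 0) ⊛ B → A ≈ B
    2-cancel A B 2A≈2B n n<N = ℤ.*-cancelˡ-≡ (ℤ.+ 2) (A n) (B n)
      (trans (sym (double A)) (trans (2A≈2B n n<N) (double B)))
      where
      double : ∀ A → ((q^ 0 ⊕ q^ 0) ⊛ A) n ≡ ℤ.+ 2 * A n
      double A = trans (⊛-distribʳ A (q^ 0) (q^ 0) n)
        (trans (cong₂ _+_ (⊛-identityˡ A n) (⊛-identityˡ A n))
          (trans (cong₂ _+_ (sym (ℤ.*-identityˡ (A n))) (sym (ℤ.*-identityˡ (A n))))
            (sym (ℤ.*-distribʳ-+ (A n) 1ℤ 1ℤ))))

    -- `Y` is formed from geometric sums by addition and multiplication alone.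
    Y-cubic⁺ : ∀ {u v p} m → Cubic u → Cubic v → Cubic p → Cubic⁺ (Y m u v p)
    Y-cubic⁺ zero    u v p = 1-cubic⁺
    Y-cubic⁺ (suc m) u v p = ⊛-cubic⁺ (Y-cubic⁺ m u v p) (⊕-cubic⁺ (geo-cubic⁺ 0<N (⊛-cubic u (^-cubic m p)))
      (⊛-cubic y (geo-cubic N y)))
      where y = ⊛-cubic v (^-cubic m p)

    Q : Series
    Q = (q^ 1) ^ 3

    Q-shift : ∀ n → Q (3 ℕ.+ n) ≡ (q^ 0) n
    Q-shift n = trans (q⊛-suc ((q^ 1) ^ 2) (2 ℕ.+ n)) (trans (q⊛-suc ((q^ 1) ^ 1) (1 ℕ.+ n)) (q⊛-suc (q^ 0) n))

    Q-cubic : Cubic Q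
    Q-cubic = record
      { nonneg = ⊛-nonneg q-nonneg (⊛-nonneg q-nonneg (⊛-nonneg q-nonneg (nonneg 1-cubic)))
      ; [1+3k] = λ { zero → refl ; (suc k) → Q-shift (1 ℕ.+ k ℕ.* 3) }
      ; [2+3k] = λ { zero → refl ; (suc k) → Q-shift (2 ℕ.+ k ℕ.* 3) }
      }
      where
      q-nonneg : Nonneg (q^ 1)
      q-nonneg zero          = ℤ.≤-refl
      q-nonneg (suc zero)    = ℤ.+≤+ ℕ.z≤n
      q-nonneg (suc (suc _)) = ℤ.≤-refl

    -- In A (1 + z + z²) a positive Aₙ survives through the 1, and a positive zₙ through A₀ zₙ.
    g₃-step-pos : ∀ A z n → Cubic⁺ A → Cubic z → 0ℤ < A n ⊎ 0ℤ < z n → 0ℤ < (A ⊛ (q^ 0 ⊕ (z ⊕ z ^ 2))) n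
    g₃-step-pos A z n a cz (inj₁ 0<Aₙ) =
      ⊛-posʳ A (q^ 0 ⊕ (z ⊕ z ^ 2)) n a (⊕-cubic⁺ 1-cubic⁺ (⊕-cubic cz (^-cubic 2 cz))) 0<Aₙ
    g₃-step-pos A z n (a , 0<A₀) cz (inj₂ 0<zₙ) =
      ⊛-pos {A} {q^ 0 ⊕ (z ⊕ z ^ 2)} n (nonneg a) (nonneg (⊕-cubic 1-cubic (⊕-cubic cz (^-cubic 2 cz)))) 0<A₀
        (ℤ.+-mono-≤-< (nonneg 1-cubic n) (ℤ.+-mono-<-≤ 0<zₙ (nonneg (^-cubic 2 cz) n)))

    Q^-pos : ∀ k {n} → n ≡ k ℕ.* 3 → n ℕ.< N → 0ℤ < (Q ^ k) n
    Q^-pos k {n} refl n<N = subst (0ℤ <_) (sym Q^kₙ≡1) (ℤ.+<+ (ℕ.s≤s ℕ.z≤n))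
      where
      Q^kₙ≡1 : (Q ^ k) n ≡ 1ℤ
      Q^kₙ≡1 = trans (^-*-assoc (q^ 1) 3 k (ℕ.*-comm 3 k) n n<N) (trans (^-q^ n n n<N) (q^-≡ n))

    -- Induction on m: up to k = m positivity is inherited, and the new factor brings the power
    -- Q^(m+1) that settles k = m + 1.
    g₃-pos : ∀ m k {n} → n ≡ k ℕ.* 3 → k ℕ.≤ m → n ℕ.< N → 0ℤ < g₃ m Q Q n
    g₃-pos zero    zero refl _     _   = ℤ.+<+ (ℕ.s≤s ℕ.z≤n)
    g₃-pos (suc m) k {n} n≡3k k≤1+m n<N =
      g₃-step-pos (g₃ m Q Q) (Q ⊛ Q ^ m) n (g₃-cubic⁺ m Q-cubic Q-cubic) (⊛-cubic Q-cubic (^-cubic m Q-cubic))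
        (case (ℕ.m≤n⇒m<n∨m≡n k≤1+m))
      where
      case : k ℕ.< suc m ⊎ k ≡ suc m → 0ℤ < g₃ m Q Q n ⊎ 0ℤ < (Q ⊛ Q ^ m) n
      case (inj₁ k<1+m) = inj₁ (g₃-pos m k n≡3k (ℕ.s≤s⁻¹ k<1+m) n<N)
      case (inj₂ k≡1+m) = inj₂ (Q^-pos (suc m) (trans n≡3k (cong (ℕ._* 3) k≡1+m)) n<N)

    -- The products `f j` in the truncated ring

    module Ring = CommutativeRing (truncatedRing N)

    partialProduct-E : ∀ j m → partialProduct j m ≈ E m ((q^ 1) ^ j)
    partialProduct-E j zero    = Ring.refl {q^ 0}
    partialProduct-E j (suc m) = begin
      (q^ 0 ⊖ q^ (j ℕ.* suc m)) ⊛ partialProduct j m   ≈⟨ *-cong factor (partialProduct-E j m) ⟩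
      (q^ 0 ⊕ -1# ⊛ x ⊛ x ^ m) ⊛ E m x                 ≈⟨ Ring.*-comm (q^ 0 ⊕ -1# ⊛ x ⊛ x ^ m) (E m x) ⟩
      E m x ⊛ (q^ 0 ⊕ -1# ⊛ x ⊛ x ^ m)                 ∎
      where
      open import Relation.Binary.Reasoning.Setoid Ring.setoid
      x : Series
      x = (q^ 1) ^ j
      factor : q^ 0 ⊖ q^ (j ℕ.* suc m) ≈ q^ 0 ⊕ -1# ⊛ x ⊛ x ^ m
      factor = Ring.+-congˡ {q^ 0} (begin
        ⊝ (q^ (j ℕ.* suc m))      ≈⟨ Ring.-‿cong (^-q^ (j ℕ.* suc m)) ⟨
        ⊝ ((q^ 1) ^ (j ℕ.* suc m)) ≈⟨ Ring.-‿cong (^-assocʳ (q^ 1) j (suc m)) ⟨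
        ⊝ (x ^ suc m)             ≈⟨ -1*x≈-x (x ^ suc m) ⟨
        -1# ⊛ (x ⊛ x ^ m)         ≈⟨ Ring.*-assoc -1# x (x ^ m) ⟨
        -1# ⊛ x ⊛ x ^ m           ∎)

    -- Coefficient n of `f j` is read off the n-th partial product; `f-limit` lengthens that to the
    -- N-th.
    f-E∞ : ∀ j .{{_ : ℕ.NonZero j}} → f j ≈ E∞ ((q^ 1) ^ j)
    f-E∞ j n n<N = trans (sym (f-limit j n (N ℕ.∸ n)))
      (trans (cong (λ m → partialProduct j m n) (ℕ.m∸n+n≡m (ℕ.<⇒≤ n<N))) (partialProduct-E j N n n<N))

    a-thirds : a-1¹2¹3⁻² ≈ X₀ Q ⊕ -1# ⊛ (q^ 1 ⊛ (X₁ Q ⊕ q^ 1 ⊛ (X₂ Q ⊕ X₂ Q)))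
    a-thirds = quotient-thirds q-nil 2-cancel {a-1¹2¹3⁻²} {f 1} {f 2} {f 3} {Q} refl (f-E∞ 1) (f-E∞ 2) (f-E∞ 3)
      (λ n _ → a-1¹2¹3⁻²-generating n)

    g-multiple-cubic : ∀ {A} → Cubic⁺ A → Cubic (g Q ⊛ A)
    g-multiple-cubic a = ⊛-cubic (proj₁ (g₃-cubic⁺ N Q-cubic Q-cubic)) (proj₁ a)

    g-multiple-pos : ∀ {A n} k → Cubic⁺ A → n ≡ k ℕ.* 3 → n ℕ.< N → 0ℤ < (g Q ⊛ A) n
    g-multiple-pos {A} {n} k a n≡3k n<N = ⊛-posʳ (g Q) A n (g₃-cubic⁺ N Q-cubic Q-cubic) a
      -- The product has enough factors, as k ≤ 3k = n < N.
      (g₃-pos N k n≡3k (ℕ.≤-trans (ℕ.m≤m*n k 3) (ℕ.≤-trans (ℕ.≤-reflexive (sym n≡3k)) (ℕ.<⇒≤ n<N))) n<N)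

    h-cubic⁺ : Cubic⁺ (h (Q ^ 3))
    h-cubic⁺ = P-cubic⁺ N (^-cubic 3 Q-cubic) (^-cubic 3 Q-cubic)

    X₀/g-cubic⁺ : Cubic⁺ (Y N Q (Q ^ 2) (Q ^ 3) ⊛ W Q)
    X₀/g-cubic⁺ = ⊛-cubic⁺ (Y-cubic⁺ N Q-cubic (^-cubic 2 Q-cubic) (^-cubic 3 Q-cubic))
      (⊛-cubic⁺ (P-cubic⁺ N Q-cubic (^-cubic 3 Q-cubic)) (P-cubic⁺ N (^-cubic 2 Q-cubic) (^-cubic 3 Q-cubic)))

    X₁/g-cubic⁺ : Cubic⁺ (g Q ⊛ h (Q ^ 3))
    X₁/g-cubic⁺ = ⊛-cubic⁺ (g₃-cubic⁺ N Q-cubic Q-cubic) h-cubic⁺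

    X₂/g-cubic⁺ : Cubic⁺ (g₃ N (Q ^ 2) (Q ^ 2) ⊛ h (Q ^ 3) ^ 3)
    X₂/g-cubic⁺ = ⊛-cubic⁺ (g₃-cubic⁺ N (^-cubic 2 Q-cubic) (^-cubic 2 Q-cubic))
      (⊛-cubic⁺ h-cubic⁺ (⊛-cubic⁺ h-cubic⁺ (⊛-cubic⁺ h-cubic⁺ 1-cubic⁺)))

    X₀-cubic : Cubic (X₀ Q)
    X₀-cubic = g-multiple-cubic X₀/g-cubic⁺

    X₁-cubic : Cubic (X₁ Q)
    X₁-cubic = g-multiple-cubic X₁/g-cubic⁺

    X₂-cubic : Cubic (X₂ Q)
    X₂-cubic = g-multiple-cubic X₂/g-cubic⁺

    -- Signs in the three residue classes

    a-coefficient : ∀ i → i ℕ.< N → a-1¹2¹3⁻² i ≡ X₀ Q i ℤ.- negativePart (X₁ Q) (X₂ Q) i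
    a-coefficient i i<N = trans (a-thirds i i<N)
      (cong (X₀ Q i +_) (-1*x≈-x (negativePart (X₁ Q) (X₂ Q)) i i<N))

    a-3k : ∀ k {i} → i ≡ k ℕ.* 3 → i ℕ.< N → 0ℤ < a-1¹2¹3⁻² i
    a-3k k {i} refl i<N = subst (0ℤ <_) (sym (a-coefficient i i<N))
      (pos-< (negativePart-3k X₁-cubic X₂-cubic k) (g-multiple-pos k X₀/g-cubic⁺ refl i<N))

    a-1+3k : ∀ k {j} → j ≡ k ℕ.* 3 → 1 ℕ.+ j ℕ.< N → a-1¹2¹3⁻² (1 ℕ.+ j) < 0ℤ
    a-1+3k k {j} refl 1+j<N = subst (_< 0ℤ) (sym (a-coefficient (1 ℕ.+ j) 1+j<N))
      (neg-< ([1+3k] X₀-cubic k)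
        (negativePart-1+3k X₁-cubic X₂-cubic k (g-multiple-pos k X₁/g-cubic⁺ refl (ℕ.m+n≤o⇒n≤o 1 1+j<N))))

    a-2+3k : ∀ k {j} → j ≡ k ℕ.* 3 → 2 ℕ.+ j ℕ.< N → a-1¹2¹3⁻² (2 ℕ.+ j) < 0ℤ
    a-2+3k k {j} refl 2+j<N = subst (_< 0ℤ) (sym (a-coefficient (2 ℕ.+ j) 2+j<N))
      (neg-< ([2+3k] X₀-cubic k)
        (negativePart-2+3k X₁-cubic X₂-cubic k (g-multiple-pos k X₂/g-cubic⁺ refl (ℕ.m+n≤o⇒n≤o 2 2+j<N))))

open import Data.Nat using (ℕ; _+_; _*_)
open import Data.Integer using (0ℤ; _<_; _>_)
open import Data.Product using (_×_)

theorem3p3 : ∀ (n : ℕ) → (a-1¹2¹3⁻² (3 * n) > 0ℤ) × (a-1¹2¹3⁻² (3 * n + 1) < 0ℤ) × (a-1¹2¹3⁻² (3 * n + 2) < 0ℤ)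
theorem3p3 n
  -- Brings the indices into the form r + n * 3 of the lemmas on series in q³.
  rewrite ℕ.+-comm (3 * n) 1 | ℕ.+-comm (3 * n) 2 | ℕ.*-comm 3 n
  -- Each coefficient gets its own truncation: `ℕ.≤-refl` sets N to the index plus one.
  = Positivity.Truncated.a-3k _ (ℕ.s≤s ℕ.z≤n) n ≡.refl ℕ.≤-refl
  , Positivity.Truncated.a-1+3k _ (ℕ.s≤s ℕ.z≤n) n ≡.refl ℕ.≤-refl
  , Positivity.Truncated.a-2+3k _ (ℕ.s≤s ℕ.z≤n) n ≡.refl ℕ.≤-refl
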